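{- Let $G=(V,E)$ be an unweighted, undirected, simple graph. The algorithm PATH-CORE (specified in the context), run on $G$, outputs the Path-Core scores for all vertices of $G$; that is, for every $w\in V$, the output value $C_P(w)$ equals $$\sum_{(j,k)\in E(V\setminus w)} \frac{\sigma_{jk}(w)\vert_{G\setminus (j,k)}}{\sigma_{jk}\vert_{G\setminus (j,k)}}.$$
   Context: Path-Core score. $E(X)$ denotes the set of edges of $G$ induced by the vertex set $X$, so the sum in the claim is over the edges of $G$ not incident to $w$. For an edge $(j,k)\in E$, $G\setminus (j,k)$ is the graph obtained from $G$ by removing this edge. $\sigma_{jk}\vert_{G\setminus(j,k)}$ is the number of shortest paths between $j$ and $k$ in $G\setminus (j,k)$, and $\sigma_{jk}(w)\vert_{G\setminus(j,k)}$ is the number of those shortest paths that contain the vertex $w$. Algorithm PATH-CORE. Input: $G$. Output: $C_P$ (a value for each vertex). $\Gamma_{G'}(w)$ is the set of neighbours of $w$ in the graph $G'$. Set $C_P(w)\leftarrow 0$ for all $w \in V$. For each edge $(s,t)\in E$, do the following. (0) Set $G' \leftarrow G\setminus (s,t)$; set $\sigma_s(w),\sigma_t(w)\leftarrow 0$ for all $w\in V$; set $\sigma_s(s),\sigma_t(t)\leftarrow 1$; set $d_s(w), d_t(w) \leftarrow -1$ for all $w\in V$; set $d_s(s),d_t(t)\leftarrow 0$; let $Q$ be an empty queue. (1) First search. Enqueue $s$ in $Q$. While $Q$ is not empty: dequeue $w$ from $Q$; for each $u\in\Gamma_{G'}(w)$: if $d_s(u)<0$, then enqueue $u$ and set $d_s(u)\leftarrow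 d_s(w)+1$. (2) Second search. Enqueue $t$ in $Q$. While $Q$ is not empty: dequeue $w$ from $Q$; for each $u\in\Gamma_{G'}(w)$: (i) if $d_t(u)<0$, then enqueue $u$ and set $d_t(u)\leftarrow d_t(w)+1$; (ii) if $d_s(u)<d_s(w)$, then set $\sigma_t(u)\leftarrow\sigma_t(u)+\sigma_t(w)$. (3) Third search. Enqueue $s$ in $Q$. While $Q$ is not empty: dequeue $w$ from $Q$; for each $u\in\Gamma_{G'}(w)$: if $d_t(u)<d_t(w)$, then enqueue $u$ and set $\sigma_s(u)\leftarrow\sigma_s(u)+\sigma_s(w)$. (4) For each $w\in V\setminus\{s,t\}$: set $C_P(w)\leftarrow C_P(w)+\sigma_s(w)\cdot\sigma_t(w)/\sigma_s(t)$. After all edges have been processed, output $C_P$.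
   Formalization: The queue Q holds each vertex at most once: enqueuing a vertex already waiting in Q does nothing (with duplicate entries the third search miscounts and the claim is false). For an edge whose removal disconnects its ends, 0/0 is read as 0 in both the score and step (4). -}

module Defs where

open import Level using (0ℓ)
open import Data.Bool using (if_then_else_)
open import Data.Nat as ℕ using (ℕ; zero; suc)
open import Data.Integer as ℤ using (ℤ; +_; -1ℤ; 0ℤ; 1ℤ)
open import Data.Rational as ℚ using (ℚ; 0ℚ)
open import Data.Fin using (Fin; _<?_; _≟_)
open import Data.Fin.Subset as Subset using (Subset; ⊤)
open import Data.Fin.Subset.Properties using () renaming (_∈?_ to _∈ₛ?_)
open import Data.List using
  (List; []; _∷_; _∷ʳ_; allFin; cartesianProduct; cartesianProductWith;
   concatMap; filter; foldl; foldr; head; last; length; map; upTo)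
open import Data.List.Membership.Propositional using (_∈_)
open import Data.List.Relation.Unary.All using (All; all?)
open import Data.List.Relation.Unary.AllPairs using (AllPairs)
open import Data.List.Relation.Unary.Any using (Any)
open import Data.List.Relation.Unary.Linked using (Linked; linked?)
open import Data.List.Relation.Unary.Unique.Propositional using (Unique)
open import Data.Maybe using (just)
open import Data.Maybe.Properties using (≡-dec)
open import Data.Product using (_×_; _,_; uncurry; ∃-syntax)
open import Data.Sum using (_⊎_; inj₁; inj₂)
open import Data.Vec.Functional using (updateAt)
open import Function using (_⇔_; const)
open import Relation.Binary using (Rel; Decidable; Symmetric; Irreflexive)
open import Relation.Binary.PropositionalEquality using (_≡_)
open import Relation.Nullary using (Dec; ¬_; ¬?; ⌊_⌋; _×-dec_; _⊎-dec_)
import Data.List.Membership.DecPropositional as DecMembership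
import Data.List.Relation.Unary.Unique.DecPropositional as DecUnique

private
  variable
    n : ℕ

record Graph (n : ℕ) : Set₁ where
  field
    Adj        : Rel (Fin n) 0ℓ
    adj?       : Decidable Adj
    adj-sym    : Symmetric Adj
    adj-irrefl : Irreflexive _≡_ Adj

open Graph public

-- An edge is an unordered pair, represented by either of its two orientations.
Pair : ℕ → Set
Pair n = Fin n × Fin n

SameEdge : Rel (Pair n) 0ℓ
SameEdge (u , v) (s , t) = (u ≡ s × v ≡ t) ⊎ (u ≡ t × v ≡ s)

sameEdge? : Decidable (SameEdge {n})
sameEdge? (u , v) (s , t) =
  (u ≟ s ×-dec v ≟ t) ⊎-dec (u ≟ t ×-dec v ≟ s)

infixl 6 _∖_

_∖_ : Graph n → Pair n → Graph n
Adj        (G ∖ e) u v = Adj G u v × ¬ SameEdge (u , v) e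
adj?       (G ∖ e) u v = adj? G u v ×-dec ¬? (sameEdge? (u , v) e)
adj-sym    (G ∖ e) (uv , ¬e) =
  adj-sym G uv , λ where
    (inj₁ (v≡s , u≡t)) → ¬e (inj₂ (u≡t , v≡s))
    (inj₂ (v≡t , u≡s)) → ¬e (inj₁ (u≡s , v≡t))
adj-irrefl (G ∖ e) u≡v (uv , _) = adj-irrefl G u≡v uv

-- E G X: the edges with both ends in X, each listed once, smaller end first.
E : Graph n → Subset n → List (Pair n)
E {n} G X =
  filter (λ (j , k) → j <? k ×-dec adj? G j k ×-dec
                      j ∈ₛ? X ×-dec k ∈ₛ? X)
         (cartesianProduct (allFin n) (allFin n))

IsPath : Graph n → Fin n → Fin n → List (Fin n) → Set
IsPath G j k p =
  head p ≡ just j × last p ≡ just k × Linked (Adj G) p × Unique p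

isPath? : (G : Graph n) (j k : Fin n) (p : List (Fin n)) → Dec (IsPath G j k p)
isPath? G j k p =
  ≡-dec _≟_ (head p) (just j) ×-dec ≡-dec _≟_ (last p) (just k) ×-dec
  linked? (adj? G) p ×-dec DecUnique.unique? _≟_ p

words : ℕ → List (List (Fin n))
words         zero    = [] ∷ []
words {n = n} (suc l) = cartesianProductWith _∷_ (allFin n) (words l)

-- The vertices of a path are distinct, so there are at most n of them, and
-- searching the words of length 0, …, n misses no path.
paths : Graph n → Fin n → Fin n → List (List (Fin n))
paths {n} G j k = filter (isPath? G j k) (concatMap words (upTo (suc n)))

shortestPaths : Graph n → Fin n → Fin n → List (List (Fin n))
shortestPaths G j k =
  filter (λ p → all? (λ q → length p ℕ.≤? length q) (paths G j k))
         (paths G j k)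

σ : Graph n → Fin n → Fin n → ℕ
σ G j k = length (shortestPaths G j k)

σ-through : Graph n → Fin n → Fin n → Fin n → ℕ
σ-through G j k w =
  length (filter (DecMembership._∈?_ _≟_ w) (shortestPaths G j k))

-- When (j , k) is a bridge, both numerator and denominator are 0, in the score
-- as well as in the algorithm; such an edge contributes nothing.
infixl 7 _÷_

_÷_ : ℕ → ℕ → ℚ
a ÷ zero      = 0ℚ
a ÷ b@(suc _) = + a ℚ./ b

score : Graph n → Fin n → ℚ
score G w =
  foldr ℚ._+_ 0ℚ
    (map (λ (j , k) → σ-through (G ∖ (j , k)) j k w ÷ σ (G ∖ (j , k)) j k)
         (E G (⊤ Subset.- w)))

-- The orders in which the "for each" loops run. The order of the neighbours of
-- a vertex may depend on which edge has been removed.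
record LoopOrder (G : Graph n) : Set where
  field
    edges       : List (Pair n)
    edges-sound : All (uncurry (Adj G)) edges
    edges-once  : AllPairs (λ e f → ¬ SameEdge e f) edges
    edges-all   : ∀ u v → Adj G u v → Any (SameEdge (u , v)) edges

    Γ           : Pair n → Fin n → List (Fin n)
    Γ-once      : ∀ e w → Unique (Γ e w)
    Γ-nbrs      : ∀ e w u → u ∈ Γ e w ⇔ Adj (G ∖ e) w u

record State (n : ℕ) : Set where
  field
    Q     : List (Fin n)
    dₛ dₜ : Fin n → ℤ
    σₛ σₜ : Fin n → ℕ

open State public

initial : Pair n → State n
initial (s , t) = record
  { Q  = []
  ; dₛ = updateAt (const -1ℤ) s (const 0ℤ)
  ; dₜ = updateAt (const -1ℤ) t (const 0ℤ)
  ; σₛ = updateAt (const 0) s (const 1)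
  ; σₜ = updateAt (const 0) t (const 1)
  }

-- A vertex that is already waiting in the queue is not queued a second time.
-- The first two searches never attempt this, but the third one does, since its
-- test dₜ u < dₜ w may succeed for several w. If duplicates were kept, each
-- copy of u would pass on σₛ u again, and the σₛ would not be path counts: with
-- edges 01, 02, 13, 23, 34, 04, the output at vertex 0 would be 5/2 (the score
-- is 3).
enqueue : Fin n → State n → State n
enqueue u S =
  if ⌊ DecMembership._∈?_ _≟_ u (Q S) ⌋ then S else record S { Q = Q S ∷ʳ u }

discover-dₛ discover-dₜ count-σₜ visit₁ visit₂ visit₃ :
  Fin n → State n → Fin n → State n

discover-dₛ w S u =
  if ⌊ dₛ S u ℤ.<? 0ℤ ⌋
  then (let S′ = enqueue u S in
        record S′ { dₛ = updateAt (dₛ S′) u (const (dₛ S′ w ℤ.+ 1ℤ)) })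
  else S

discover-dₜ w S u =
  if ⌊ dₜ S u ℤ.<? 0ℤ ⌋
  then (let S′ = enqueue u S in
        record S′ { dₜ = updateAt (dₜ S′) u (const (dₜ S′ w ℤ.+ 1ℤ)) })
  else S

count-σₜ w S u =
  if ⌊ dₛ S u ℤ.<? dₛ S w ⌋
  then record S { σₜ = updateAt (σₜ S) u (ℕ._+ σₜ S w) }
  else S

visit₁ w S u = discover-dₛ w S u

visit₂ w S u = count-σₜ w (discover-dₜ w S u) u

visit₃ w S u =
  if ⌊ dₜ S u ℤ.<? dₜ S w ⌋
  then (let S′ = enqueue u S in
        record S′ { σₛ = updateAt (σₛ S′) u (ℕ._+ σₛ S′ w) })
  else S

-- Big-step semantics of "while Q is not empty: dequeue w; for each u in Γ w:
-- visit u". A derivation is a terminating run.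
data While (Γ : Fin n → List (Fin n))
           (visit : Fin n → State n → Fin n → State n) : Rel (State n) 0ℓ where
  stop : ∀ {S} → Q S ≡ [] → While Γ visit S S
  loop : ∀ {S S′ w q} → Q S ≡ w ∷ q →
         While Γ visit (foldl (visit w) (record S { Q = q }) (Γ w)) S′ →
         While Γ visit S S′

Searches : (Fin n → List (Fin n)) → Pair n → State n → Set
Searches Γ (s , t) S =
  ∃[ S₁ ] ∃[ S₂ ]
    While Γ visit₁ (enqueue s (initial (s , t))) S₁ ×
    While Γ visit₂ (enqueue t S₁) S₂ ×
    While Γ visit₃ (enqueue s S₂) S

accumulate : Pair n → State n → (Fin n → ℚ) → (Fin n → ℚ)
accumulate (s , t) S C w =
  if ⌊ w ≟ s ⊎-dec w ≟ t ⌋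
  then C w
  else C w ℚ.+ (σₛ S w ℕ.* σₜ S w) ÷ σₛ S t

data ForEdges (Γ : Pair n → Fin n → List (Fin n)) :
              List (Pair n) → Rel (Fin n → ℚ) 0ℓ where
  []  : ∀ {C} → ForEdges Γ [] C C
  _∷_ : ∀ {e es S C C′} → Searches (Γ e) e S →
        ForEdges Γ es (accumulate e S C) C′ → ForEdges Γ (e ∷ es) C C′

-- PathCore G o Cₚ: run on G with loop order o, the algorithm terminates with
-- output Cₚ.
PathCore : (G : Graph n) → LoopOrder G → (Fin n → ℚ) → Set
PathCore G o Cₚ = ForEdges Γ edges (const 0ℚ) Cₚ
  where open LoopOrder o

{-# OPTIONS --safe #-}

-- Fix an edge (s , t), let G′ be G without it, and let δ be the distance of s
-- and t in G′. All three searches are breadth-first searches of a relation: the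
-- first two follow the edges of G′, the third one the edges that decrease dₜ.
-- So dₛ and dₜ are the distances from s and t, and when a vertex w is dequeued
-- all vertices that contribute to its counter have been dequeued before. Hence
-- σₛ w is the number of walks from w to s of length δ ∸ dₜ w, and σₜ w that of
-- walks from w to t of length δ ∸ dₛ w. If w lies on a shortest path then these
-- lengths are dₛ w and dₜ w, and the product counts the shortest paths through
-- w; otherwise δ ∸ dₜ w < dₛ w, and the product vanishes. A walk whose length
-- is the distance of its ends repeats no vertex, so that shortest paths may be
-- counted as walks. When (s , t) is a bridge, dₜ is constant on the component
-- of s, and σₛ t is 0.

module Submission where

open import Defs
open import Level using (0ℓ)
open import Data.Bool using (if_then_else_; true; false)
open import Data.Fin as Fin using (Fin; zero; suc; _≟_)
import Data.Fin.Properties as Finₚ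
open import Data.Fin.Subset as Subset using (⊤)
open import Data.Fin.Subset.Properties using (∈⊤; x∈p∧x≢y⇒x∈p-y) renaming (_∈?_ to _∈ₛ?_)
open import Data.Integer as ℤ using (ℤ; 0ℤ; 1ℤ; -1ℤ; ∣_∣)
import Data.Integer.Properties as ℤₚ
open import Data.List
  using (List; []; _∷_; _∷ʳ_; _++_; allFin; cartesianProduct; concat; concatMap;
         filter; foldl; foldr; head; last; length; map; tabulate; upTo)
open import Data.List.Properties
  using (∷-injective; ∷ʳ-++; ++-assoc; ++-identityʳ; length-++; length-filter; length-map;
         length-tabulate; filter-++; filter-accept; filter-all; filter-none; filter-reject;
         filter-≐; map-∘)
import Data.List.Membership.DecPropositional as DecMembership
open import Data.List.Membership.Propositional using (_∈_; _∉_; find)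
open import Data.List.Membership.Propositional.Properties
  using (∈-++⁺ˡ; ∈-++⁺ʳ; ∈-++⁻; ∈-allFin; ∈-cartesianProduct⁺; ∈-cartesianProductWith⁺;
         ∈-cartesianProductWith⁻; ∈-concat⁺′; ∈-concat⁻′; ∈-filter⁺; ∈-filter⁻; ∈-insert;
         ∈-map⁺; ∈-map⁻; ∈-tabulate⁺; ∈-tabulate⁻; ∈-upTo⁺)
open import Data.List.Membership.Propositional.Properties.WithK using (unique∧set⇒bag)
open import Data.List.Relation.Binary.BagAndSetEquality using (∼bag⇒↭)
open import Data.List.Relation.Binary.Disjoint.Propositional using (Disjoint)
open import Data.List.Relation.Binary.Permutation.Propositional using (_↭_; ↭⇒↭ₛ)
import Data.List.Relation.Binary.Permutation.Propositional.Properties as ↭ₚ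
import Data.List.Relation.Binary.Permutation.Setoid.Properties as ↭ₛₚ
open import Data.List.Relation.Unary.All as All using ([]; _∷_)
import Data.List.Relation.Unary.All.Properties as Allₚ
open import Data.List.Relation.Unary.AllPairs as AllPairs using ([]; _∷_)
import Data.List.Relation.Unary.AllPairs.Properties as AllPairsₚ
open import Data.List.Relation.Unary.Any using (here; there)
open import Data.List.Relation.Unary.Linked using (Linked; [-]; _∷_)
open import Data.List.Relation.Unary.Unique.Propositional using (Unique)
import Data.List.Relation.Unary.Unique.Propositional.Properties as Uniqueₚ
open import Data.Maybe using (just)
open import Data.Maybe.Properties using (just-injective)
open import Data.Nat
  using (ℕ; zero; suc; _+_; _*_; _∸_; _≤_; _<_; z≤n; s≤s; _≤?_; _<?_)
open import Data.Nat.Properties as ℕₚ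
  using (+-identityʳ; +-suc; +-comm; +-assoc; +-∸-assoc; *-assoc; *-comm; *-zeroʳ;
         m∸n+n≡m; m+n∸n≡m; m≤n⇒m∸n≡0; m≤n⇒m≤1+n; ≤-refl; ≤-trans; ≤-reflexive; ≤-antisym;
         ≰⇒>; ≮⇒≥; <⇒≱; <⇒≤; <-irrefl; module ≤-Reasoning)
open import Data.Product using (_×_; _,_; ∃; ∃-syntax; proj₁; proj₂)
open import Data.Rational as ℚ using (ℚ)
import Data.Rational.Properties as ℚₚ
open import Data.Sum using (_⊎_; inj₁; inj₂; swap; [_,_]′)
open import Data.Vec.Base using (_∷_; there)
open import Data.Vec.Functional using (updateAt)
open import Data.Vec.Functional.Properties using (updateAt-updates; updateAt-minimal)
open import Function using (_∘_; _⇔_; mk⇔; const; id; Equivalence)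
open import Relation.Binary using (Rel; tri<; tri≈; tri>)
open import Relation.Binary.PropositionalEquality
  using (_≡_; _≢_; refl; sym; trans; cong; cong₂; subst; subst₂; setoid; module ≡-Reasoning)
open import Relation.Nullary using (Dec; yes; no; ¬_; ¬?; does; ⌊_⌋; contradiction; _×-dec_; _⊎-dec_)
open import Relation.Nullary.Decidable using (dec-true; dec-false; does-⇔)

open import Algebra.Properties.Semiring.Sum ℕₚ.+-*-semiring

-- Two orders meet in a counting search: vertices leave the queue by depth, whereas the test that
-- raises a counter compares the labels of the search from the other end. They are reconciled by a
-- single property of those labels `g`, that they change by at most one along an edge. A walk from
-- `u` to the root `r` then has length at least `g r ∸ g u`, and one of exactly this length climbs
-- by one at every step. So the number of these walks obeys the recurrence that the counters
-- compute, for every vertex and not only on shortest paths, and whatever contributes to `w` lies at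
-- a smaller depth than `w`.
--
-- The label -1 of unreachable vertices seems to break this. Its absolute value 1 does not: no edge
-- joins a reachable vertex to an unreachable one, so along edges the absolute values keep both the
-- bound and the comparisons. A bridge therefore needs no separate argument until the final
-- quotient.
--
-- A run may orient an edge differently from the score. The searches are therefore analysed over any
-- graph `K` whose neighbours `Γ` lists, which lets a run for one orientation be read as a run on
-- the graph written with the other.

private
  variable
    n : ℕ
    A B : Set

-- Indicators and finite sums.

ind : {P : Set} → Dec P → ℕ
ind d = if does d then 1 else 0

ind-true : {P : Set} (d : Dec P) → P → ind d ≡ 1
ind-true d p rewrite dec-true d p = refl

ind-false : {P : Set} (d : Dec P) → ¬ P → ind d ≡ 0
ind-false d ¬p rewrite dec-false d ¬p = refl

ind-⇔ : {P Q : Set} → P ⇔ Q → (p? : Dec P) (q? : Dec Q) → ind p? ≡ ind q?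
ind-⇔ P⇔Q p? q? = cong (if_then 1 else 0) (does-⇔ P⇔Q p? q?)

ind-*-cong : {P : Set} (d : Dec P) {a b : ℕ} → (P → a ≡ b) → ind d * a ≡ ind d * b
ind-*-cong (yes p) eq = cong (1 *_) (eq p)
ind-*-cong (no _)  eq = refl

ind-*-null : {P : Set} (d : Dec P) {a : ℕ} → (P → a ≡ 0) → ind d * a ≡ 0
ind-*-null (yes p) {a} eq = trans (+-identityʳ a) (eq p)
ind-*-null (no _)      eq = refl

∑-zero : {f : Fin n → ℕ} → (∀ x → f x ≡ 0) → ∑[ x < n ] f x ≡ 0
∑-zero {n} f≡0 = trans (sum-cong-≗ f≡0) (sum-replicate-zero n)

∑-δ : (w : Fin n) (f : Fin n → ℕ) → ∑[ x < n ] (ind (x ≟ w) * f x) ≡ f w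
∑-δ {suc n} zero f =
  trans (cong₂ _+_ (+-identityʳ (f zero)) (sum-replicate-zero n)) (+-identityʳ (f zero))
∑-δ {suc n} (suc w) f = ∑-δ w (f ∘ suc)

-- The alternative carries data `P` instead of a mere inequality, so that a walk can be extracted
-- from a sum of walk counts.
∑-null⊎∃ : {f : Fin n → ℕ} {P : Fin n → Set} → (∀ x → f x ≡ 0 ⊎ P x) →
           ∑[ x < n ] f x ≡ 0 ⊎ ∃ P
∑-null⊎∃ {zero}  h = inj₁ refl
∑-null⊎∃ {suc n} h with h zero | ∑-null⊎∃ (h ∘ suc)
... | inj₂ p  | _             = inj₂ (zero , p)
... | inj₁ _  | inj₂ (x , p)  = inj₂ (suc x , p)
... | inj₁ z  | inj₁ zs       = inj₁ (cong₂ _+_ z zs)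

-- Walks and their number.

-- The root is a parameter and walks grow at the far end, the way a search extends them. `N k u v`
-- unfolds at `u` as well, hence counts walks with root `v`, the relation being symmetric.
data Walk (R : Rel (Fin n) 0ℓ) (r : Fin n) : ℕ → Fin n → Set where
  here : Walk R r 0 r
  step : ∀ {k u w} → R w u → Walk R r k w → Walk R r (suc k) u

walk-map : ∀ {R R′ : Rel (Fin n) 0ℓ} {r k u} → (∀ {w u} → R w u → R′ w u) →
           Walk R r k u → Walk R′ r k u
walk-map f here       = here
walk-map f (step e p) = step (f e) (walk-map f p)

module Counts (K : Graph n) where

  N : ℕ → Fin n → Fin n → ℕ
  N zero    u v = ind (u ≟ v)
  N (suc k) u v = ∑[ x < n ] (ind (adj? K u x) * N k x v)

  N-null⊎walk : ∀ k u v → N k u v ≡ 0 ⊎ Walk (Adj K) v k u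
  N-null⊎walk zero u v with u ≟ v
  ... | yes refl = inj₂ here
  ... | no _     = inj₁ refl
  N-null⊎walk (suc k) u v with ∑-null⊎∃ {P = λ x → Adj K u x × Walk (Adj K) v k x} dichotomy
    where
    dichotomy : ∀ x → ind (adj? K u x) * N k x v ≡ 0 ⊎ (Adj K u x × Walk (Adj K) v k x)
    dichotomy x with adj? K u x | N-null⊎walk k x v
    ... | no _   | _      = inj₁ refl
    ... | yes _  | inj₁ z = inj₁ (trans (+-identityʳ _) z)
    ... | yes ux | inj₂ p = inj₂ (ux , p)
  ... | inj₁ z            = inj₁ z
  ... | inj₂ (x , ux , p) = inj₂ (step (adj-sym K ux) p)

  N-null : ∀ {k u v} → ¬ Walk (Adj K) v k u → N k u v ≡ 0
  N-null {k} {u} {v} ¬p with N-null⊎walk k u v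
  ... | inj₁ z = z
  ... | inj₂ p = contradiction p ¬p

  N⇒walk : ∀ {k u v} → N k u v ≢ 0 → Walk (Adj K) v k u
  N⇒walk {k} {u} {v} ≢0 with N-null⊎walk k u v
  ... | inj₁ z = contradiction z ≢0
  ... | inj₂ p = p

  -- Powers of the adjacency matrix commute with the matrix: the induction step exchanges two sums.
  -- Unfolding at the other end is what `N-sym` rests on.
  N-snoc : ∀ k u v → N (suc k) u v ≡ ∑[ x < n ] (N k u x * ind (adj? K x v))
  N-snoc zero u v = begin
    ∑[ x < n ] (ind (adj? K u x) * ind (x ≟ v)) ≡⟨ sum-cong-≗ (λ x → *-comm (ind (adj? K u x)) _) ⟩
    ∑[ x < n ] (ind (x ≟ v) * ind (adj? K u x)) ≡⟨ ∑-δ v (λ x → ind (adj? K u x)) ⟩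
    ind (adj? K u v)                            ≡⟨ ∑-δ u (λ x → ind (adj? K x v)) ⟨
    ∑[ x < n ] (ind (x ≟ u) * ind (adj? K x v))
      ≡⟨ sum-cong-≗ (λ x → cong (_* _) (ind-⇔ (mk⇔ sym sym) (x ≟ u) (u ≟ x))) ⟩
    ∑[ x < n ] (ind (u ≟ x) * ind (adj? K x v)) ∎
    where open ≡-Reasoning
  N-snoc (suc k) u v = begin
    ∑[ y < n ] (a u y * N (suc k) y v)
      ≡⟨ sum-cong-≗ (λ y → cong (a u y *_) (N-snoc k y v)) ⟩
    ∑[ y < n ] (a u y * ∑[ x < n ] (N k y x * a x v))
      ≡⟨ sum-cong-≗ (λ y → *-distribˡ-sum (a u y) (λ x → N k y x * a x v)) ⟩
    ∑[ y < n ] ∑[ x < n ] (a u y * (N k y x * a x v))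
      ≡⟨ ∑-comm (λ y x → a u y * (N k y x * a x v)) ⟩
    ∑[ x < n ] ∑[ y < n ] (a u y * (N k y x * a x v))
      ≡⟨ sum-cong-≗ (λ x → sum-cong-≗ (λ y → *-assoc (a u y) (N k y x) (a x v))) ⟨
    ∑[ x < n ] ∑[ y < n ] (a u y * N k y x * a x v)
      ≡⟨ sum-cong-≗ (λ x → *-distribʳ-sum (a x v) (λ y → a u y * N k y x)) ⟨
    ∑[ x < n ] (N (suc k) u x * a x v) ∎
    where
    open ≡-Reasoning
    a : Fin n → Fin n → ℕ
    a x y = ind (adj? K x y)

  N-sym : ∀ k u v → N k u v ≡ N k v u
  N-sym zero    u v = ind-⇔ (mk⇔ sym sym) (u ≟ v) (v ≟ u)
  N-sym (suc k) u v = trans (N-snoc k u v) (sum-cong-≗ λ x → trans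
    (cong₂ _*_ (N-sym k u x) (ind-⇔ (mk⇔ (adj-sym K) (adj-sym K)) (adj? K x v) (adj? K v x)))
    (*-comm (N k x u) _))

  -- Walks that climb a Lipschitz function.

  Lipschitz : (Fin n → ℕ) → Set
  Lipschitz g = ∀ {x u} → Adj K x u → g x ≤ suc (g u)

  -- The counts in PATH-CORE run over the walks that climb g by one at each
  -- step; as g is Lipschitz, these are the walks whose length is the climb.
  climbing : (Fin n → ℕ) → Fin n → Fin n → ℕ
  climbing g r u = N (g r ∸ g u) u r

  module Climb (g : Fin n → ℕ) (lip : Lipschitz g) (r : Fin n) where

    F : Fin n → ℕ
    F = climbing g r

    climb≤length : ∀ {k u} → Walk (Adj K) r k u → g r ≤ k + g u
    climb≤length here = ≤-refl
    climb≤length {suc k} {u} (step {w = w} wu p) = begin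
      g r           ≤⟨ climb≤length p ⟩
      k + g w       ≤⟨ ℕₚ.+-monoʳ-≤ k (lip wu) ⟩
      k + suc (g u) ≡⟨ +-suc k (g u) ⟩
      suc k + g u   ∎
      where open ≤-Reasoning

    rise≤length : ∀ {k u} → Walk (Adj K) r k u → g u ≤ k + g r
    rise≤length here        = ≤-refl
    rise≤length (step wu p) = ≤-trans (lip (adj-sym K wu)) (s≤s (rise≤length p))

    -- Truncated subtraction makes the length 0, and the walk of length 0 ends where it starts.
    F-top : ∀ {x} → g r < g x → F x ≡ 0
    F-top {x} r<x rewrite m≤n⇒m∸n≡0 (<⇒≤ r<x) = ind-false (x ≟ r) λ { refl → <-irrefl refl r<x }

    -- This is the recurrence that the counters follow. A walk as long as its climb cannot spare a
    -- step, so its second vertex `x` lies above `u`, and the Lipschitz bound puts it exactly one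
    -- above. If `u` is not below `r`, any `x` above `u` is above `r` too and contributes nothing.
    F-rec : ∀ u → F u ≡ ind (u ≟ r) + ∑[ x < n ] (ind (adj? K x u) * (ind (g u <? g x) * F x))
    F-rec u with g u <? g r
    ... | no u≮r rewrite m≤n⇒m∸n≡0 (≮⇒≥ u≮r) =
      sym (trans (cong (ind (u ≟ r) +_) (∑-zero null)) (+-identityʳ _))
      where
      null : ∀ x → ind (adj? K x u) * (ind (g u <? g x) * F x) ≡ 0
      null x = trans
        (cong (ind (adj? K x u) *_)
              (ind-*-null (g u <? g x) λ u<x → F-top (≤-trans (s≤s (≮⇒≥ u≮r)) u<x)))
        (*-zeroʳ (ind (adj? K x u)))
    ... | yes u<r with g r ∸ g u in eq
    ...   | zero  = contradiction (ℕₚ.m∸n≡0⇒m≤n eq) (<⇒≱ u<r)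
    ...   | suc m = sym (trans
      (cong (_+ ∑[ x < n ] (ind (adj? K x u) * t x)) (ind-false (u ≟ r) λ { refl → <-irrefl refl u<r }))
      (sum-cong-≗ λ x → trans
        (cong (_* t x) (ind-⇔ (mk⇔ (adj-sym K) (adj-sym K)) (adj? K x u) (adj? K u x)))
        (ind-*-cong (adj? K u x) (term x))))
      where
      t : Fin n → ℕ
      t x = ind (g u <? g x) * F x
      r≡ : g r ≡ suc m + g u
      r≡ = trans (sym (m∸n+n≡m (<⇒≤ u<r))) (cong (_+ g u) eq)
      term : ∀ x → Adj K u x → t x ≡ N m x r
      term x ux with g u <? g x
      ... | yes u<x = trans (trans (cong (_* F x) (ind-true (g u <? g x) u<x)) (+-identityʳ (F x)))
        (cong (λ k → N k x r)
        (trans (cong₂ _∸_ (trans r≡ (sym (+-suc m (g u)))) (≤-antisym (lip (adj-sym K ux)) u<x))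
               (m+n∸n≡m m (suc (g u)))))
      -- Without a climb in the first step, the remaining `m` steps would have to climb at least
      -- `suc m`.
      ... | no u≮x = trans (cong (_* F x) (ind-false (g u <? g x) u≮x))
        (sym (N-null λ p → <⇒≱ (≤-reflexive (sym r≡))
        (≤-trans (climb≤length p) (ℕₚ.+-monoʳ-≤ m (≮⇒≥ u≮x)))))

    F-walk : ∀ {x} → F x ≢ 0 → g x ≤ g r × Walk (Adj K) r (g r ∸ g x) x
    F-walk {x} F≢0 = ≮⇒≥ (λ r<x → F≢0 (F-top r<x)) , N⇒walk F≢0

    Descends : Rel (Fin n) 0ℓ
    Descends w u = Adj K w u × g u < g w

    -- The length equals the whole difference of `g`, and no step covers more than one of it; hence
    -- every step covers one. Read from `r`, the steps go down, which makes this a walk of the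
    -- relation that the third search follows.
    descent : ∀ {k u} → k + g u ≡ g r → Walk (Adj K) r k u → Walk Descends r k u
    descent eq here = here
    descent {suc k} {u} eq (step {w = w} wu p) = step (wu , u<w) (descent (≤-antisym w≤ (climb≤length p)) p)
      where
      w≤ : k + g w ≤ g r
      w≤ = ≤-trans (ℕₚ.+-monoʳ-≤ k (lip wu)) (≤-reflexive (trans (+-suc k (g u)) eq))
      u<w : g u < g w
      u<w = ℕₚ.+-cancelˡ-≤ k _ _ (≤-trans (≤-reflexive (trans (+-suc k (g u)) eq)) (climb≤length p))

    F-descent : ∀ {x} → F x ≢ 0 → Walk Descends r (g r ∸ g x) x
    F-descent F≢0 = let x≤r , p = F-walk F≢0 in descent (m∸n+n≡m x≤r) p

    -- Each step loses at least one. Together with `climb≤length` this fixes the length of a descent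
    -- by its end.
    descent-drop : ∀ {k u} → Walk Descends r k u → k + g u ≤ g r
    descent-drop here = ≤-refl
    descent-drop {suc k} {u} (step {w = w} (_ , u<w) p) =
      ≤-trans (≤-reflexive (sym (+-suc k (g u)))) (≤-trans (ℕₚ.+-monoʳ-≤ k u<w) (descent-drop p))

-- Lists without repetition, and words over the vertices.

_∈?_ : (x : Fin n) (xs : List (Fin n)) → Dec (x ∈ xs)
_∈?_ = DecMembership._∈?_ _≟_

unique-⇔⇒↭ : {xs ys : List A} → Unique xs → Unique ys →
             (∀ {z} → z ∈ xs → z ∈ ys) → (∀ {z} → z ∈ ys → z ∈ xs) → xs ↭ ys
unique-⇔⇒↭ xs! ys! f g = ∼bag⇒↭ (unique∧set⇒bag xs! ys! (mk⇔ f g))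

-- The pigeonhole principle. It shows that `paths` misses no path, and it bounds the number of
-- dequeued vertices.
unique⇒length≤ : {xs : List (Fin n)} → Unique xs → length xs ≤ n
unique⇒length≤ {n} {xs} xs! = begin
  length xs
    ≡⟨ ↭ₚ.↭-length (unique-⇔⇒↭ xs! (Uniqueₚ.filter⁺ (_∈? xs) (Uniqueₚ.allFin⁺ n))
         (λ {z} z∈ → ∈-filter⁺ (_∈? xs) (∈-allFin z) z∈)
         (proj₂ ∘ ∈-filter⁻ (_∈? xs) {xs = allFin n})) ⟩
  length (filter (_∈? xs) (allFin n)) ≤⟨ length-filter (_∈? xs) (allFin n) ⟩
  length (allFin n)                   ≡⟨ length-tabulate id ⟩
  n                                   ∎
  where open ≤-Reasoning

length-concat-tabulate : (h : Fin n → List A) → length (concat (tabulate h)) ≡ ∑[ x < n ] length (h x)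
length-concat-tabulate {zero}  h = refl
length-concat-tabulate {suc n} h =
  trans (length-++ (h zero)) (cong (length (h zero) +_) (length-concat-tabulate (h ∘ suc)))

filter-concat-tabulate : {P : A → Set} (P? : ∀ x → Dec (P x)) (h : Fin n → List A) →
                         filter P? (concat (tabulate h)) ≡ concat (tabulate (filter P? ∘ h))
filter-concat-tabulate {n = zero}  P? h = refl
filter-concat-tabulate {n = suc n} P? h =
  trans (filter-++ P? (h zero) _) (cong (filter P? (h zero) ++_) (filter-concat-tabulate P? (h ∘ suc)))

length-filter-map : {B : Set} {P : B → Set} (P? : ∀ x → Dec (P x)) (f : A → B) (xs : List A) →
                    length (filter P? (map f xs)) ≡ length (filter (P? ∘ f) xs)
length-filter-map P? f []       = refl
length-filter-map P? f (x ∷ xs) with does (P? (f x))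
... | true  = cong suc (length-filter-map P? f xs)
... | false = length-filter-map P? f xs

∈-words⁺ : ∀ (p : List (Fin n)) → p ∈ words (length p)
∈-words⁺ []      = here refl
∈-words⁺ (x ∷ p) = ∈-cartesianProductWith⁺ _∷_ (∈-allFin x) (∈-words⁺ p)

∈-words⁻ : ∀ l {p : List (Fin n)} → p ∈ words l → length p ≡ l
∈-words⁻ zero    (here refl) = refl
∈-words⁻ {n} (suc l) p∈ with _ , _ , _ , q∈ , refl ← ∈-cartesianProductWith⁻ _∷_ (allFin n) (words l) p∈
  = cong suc (∈-words⁻ l q∈)

words! : ∀ l → Unique (words {n} l)
words! zero    = [] ∷ []
words! {n} (suc l) = Uniqueₚ.cartesianProductWith⁺ _∷_ ∷-injective (Uniqueₚ.allFin⁺ n) (words! l)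

-- Shortest paths as walks of minimal length.

module _ (K : Graph n) where

  paths! : ∀ j k → Unique (paths K j k)
  paths! j k = Uniqueₚ.filter⁺ (isPath? K j k) (Uniqueₚ.concat⁺
    (Allₚ.map⁺ (All.universal words! (upTo (suc n))))
    (AllPairsₚ.map⁺ (AllPairs.map disjoint (Uniqueₚ.upTo⁺ (suc n)))))
    where
    disjoint : ∀ {a b} → a ≢ b → Disjoint (words {n} a) (words b)
    disjoint {a} {b} a≢b (p∈a , p∈b) = a≢b (trans (sym (∈-words⁻ a p∈a)) (∈-words⁻ b p∈b))

  ∈-paths⁺ : ∀ {j k p} → IsPath K j k p → p ∈ paths K j k
  ∈-paths⁺ {j} {k} {p} isp@(_ , _ , _ , p!) = ∈-filter⁺ (isPath? K j k)
    (∈-concat⁺′ (∈-words⁺ p) (∈-map⁺ words (∈-upTo⁺ (s≤s (unique⇒length≤ p!))))) isp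

  ∈-paths⁻ : ∀ {j k p} → p ∈ paths K j k → IsPath K j k p
  ∈-paths⁻ {j} {k} = proj₂ ∘ ∈-filter⁻ (isPath? K j k) {xs = concatMap words (upTo (suc n))}

  open Counts K

  data WalkList (v : Fin n) : ℕ → Fin n → List (Fin n) → Set where
    end : ∀ {u} → u ≡ v → WalkList v 0 u (u ∷ [])
    _∷_ : ∀ {k u x p} → Adj K u x → WalkList v k x p → WalkList v (suc k) u (u ∷ p)

  module _ {v : Fin n} where

    wl-head : ∀ {k u p} → WalkList v k u p → head p ≡ just u
    wl-head (end _)   = refl
    wl-head (_ ∷ _) = refl

    wl-last : ∀ {k u p} → WalkList v k u p → last p ≡ just v
    wl-last (end refl)            = refl
    wl-last (_ ∷ p@(end _))     = wl-last p
    wl-last (_ ∷ p@(_ ∷ _))     = wl-last p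

    wl-linked : ∀ {k u p} → WalkList v k u p → Linked (Adj K) p
    wl-linked (end _)              = [-]
    wl-linked (ux ∷ p@(end _))   = ux ∷ wl-linked p
    wl-linked (ux ∷ p@(_ ∷ _))   = ux ∷ wl-linked p

    wl-length : ∀ {k u p} → WalkList v k u p → length p ≡ suc k
    wl-length (end _)   = refl
    wl-length (_ ∷ p) = cong suc (wl-length p)

    wl-intro : ∀ {u p} → head p ≡ just u → last p ≡ just v → Linked (Adj K) p → ∃[ k ] WalkList v k u p
    wl-intro refl l [-]        = 0 , end (just-injective l)
    wl-intro refl l (ux ∷ lnk) with k , w ← wl-intro refl l lnk = suc k , ux ∷ w

    wl⇒walk : ∀ {k u p} → WalkList v k u p → Walk (Adj K) v k u
    wl⇒walk (end refl) = here
    wl⇒walk (ux ∷ p) = step (adj-sym K ux) (wl⇒walk p)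

    walk⇒wl : ∀ {k u} → Walk (Adj K) v k u → ∃ (WalkList v k u)
    walk⇒wl here = _ , end refl
    walk⇒wl (step xu p) with _ , w ← walk⇒wl p = _ , adj-sym K xu ∷ w

    wl-suffix : ∀ {k u p y} → WalkList v k u p → y ∈ p → ∃[ j ] j ≤ k × Walk (Adj K) v j y
    wl-suffix (end refl)    (here refl) = _ , ≤-refl , here
    wl-suffix w@(_ ∷ _)     (here refl) = _ , ≤-refl , wl⇒walk w
    wl-suffix (_ ∷ w) (there y∈) with j , j≤k , q ← wl-suffix w y∈ = j , m≤n⇒m≤1+n j≤k , q

  Dist : Fin n → ℕ → Fin n → Set
  Dist v k u = Walk (Adj K) v k u × (∀ {j} → Walk (Adj K) v j u → k ≤ j)

  -- If `u` occurred again, the walk from that occurrence on would be shorter. The tail is shortest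
  -- as well, since any competitor can be prolonged by the first edge.
  shortest! : ∀ {v k u p} → WalkList v k u p → (∀ {j} → Walk (Adj K) v j u → k ≤ j) → Unique p
  shortest! (end _) _ = [] ∷ []
  shortest! {v} {suc k} (ux ∷ w) min =
    Allₚ.¬Any⇒All¬ _ (λ u∈ → let _ , j≤k , q = wl-suffix w u∈ in <⇒≱ (min q) j≤k)
    ∷ shortest! w (λ q → ℕₚ.≤-pred (min (step (adj-sym K ux) q)))

  block : Fin n → (Fin n → List (List (Fin n))) → Fin n → List (List (Fin n))
  block u L x = if does (adj? K u x) then map (u ∷_) (L x) else []

  ∈-block⁻ : ∀ {u} L {x p} → p ∈ block u L x → Adj K u x × ∃[ q ] q ∈ L x × p ≡ u ∷ q
  ∈-block⁻ {u} L {x} p∈ with adj? K u x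
  ... | yes ux = ux , ∈-map⁻ (u ∷_) p∈

  ∈-block⁺ : ∀ {u} L {x q} → Adj K u x → q ∈ L x → u ∷ q ∈ block u L x
  ∈-block⁺ {u} L {x} ux q∈ rewrite dec-true (adj? K u x) ux = ∈-map⁺ (u ∷_) q∈

  -- Built in the shape of `N`, one block for each second vertex, so that lengths turn into `N`
  -- summand by summand.
  walks : ℕ → Fin n → Fin n → List (List (Fin n))
  walks zero    u v = if does (u ≟ v) then (u ∷ []) ∷ [] else []
  walks (suc k) u v =
    concat (tabulate (block u (λ x → walks k x v)))

  ∈-walks⁻ : ∀ k {u v p} → p ∈ walks k u v → WalkList v k u p
  ∈-walks⁻ zero {u} {v} p∈ with u ≟ v | p∈
  ... | yes u≡v | here refl = end u≡v
  ∈-walks⁻ (suc k) {u} {v} p∈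
    with _ , p∈ , l∈ ← ∈-concat⁻′ (tabulate (block u (λ x → walks k x v))) p∈
    with x , refl ← ∈-tabulate⁻ {f = block u (λ x → walks k x v)} l∈
    with ux , _ , q∈ , refl ← ∈-block⁻ (λ x → walks k x v) {x} p∈
    = ux ∷ ∈-walks⁻ k q∈

  ∈-walks⁺ : ∀ {k u v p} → WalkList v k u p → p ∈ walks k u v
  ∈-walks⁺ {u = u} {v} (end u≡v) rewrite dec-true (u ≟ v) u≡v = here refl
  ∈-walks⁺ {suc k} {u} {v} (_∷_ {x = x} ux w) =
    ∈-concat⁺′ (∈-block⁺ (λ x → walks k x v) ux (∈-walks⁺ w)) (∈-tabulate⁺ x)

  walks! : ∀ k u v → Unique (walks k u v)
  walks! zero u v with u ≟ v
  ... | yes _ = [] ∷ []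
  ... | no _  = []
  walks! (suc k) u v = Uniqueₚ.concat⁺ (Allₚ.tabulate⁺ each!) (AllPairsₚ.tabulate⁺ disjoint)
    where
    L : Fin n → List (List (Fin n))
    L x = walks k x v
    each! : ∀ x → Unique (block u L x)
    each! x with adj? K u x
    ... | yes _ = Uniqueₚ.map⁺ (proj₂ ∘ ∷-injective) (walks! k x v)
    ... | no _  = []
    disjoint : ∀ {x y} → x ≢ y → Disjoint (block u L x) (block u L y)
    disjoint {x} {y} x≢y (p∈x , p∈y)
      with _ , _ , q∈x , refl ← ∈-block⁻ L {x} p∈x
      with _ , _ , q∈y , refl ← ∈-block⁻ L {y} p∈y
      = x≢y (just-injective (trans (sym (wl-head (∈-walks⁻ k q∈x))) (wl-head (∈-walks⁻ k q∈y))))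

  length-walks : ∀ k u v → length (walks k u v) ≡ N k u v
  length-walks zero u v with u ≟ v
  ... | yes _ = refl
  ... | no _  = refl
  length-walks (suc k) u v = trans (length-concat-tabulate (block u L)) (sum-cong-≗ each)
    where
    L : Fin n → List (List (Fin n))
    L x = walks k x v
    each : ∀ x → length (block u L x) ≡ ind (adj? K u x) * N k x v
    each x with adj? K u x
    ... | yes _ = trans (length-map (u ∷_) (walks k x v)) (trans (length-walks k x v) (sym (+-identityʳ _)))
    ... | no _  = refl

  shortest? : ∀ s t (p : List (Fin n)) → Dec (All.All (λ q → length p ≤ length q) (paths K s t))
  shortest? s t p = All.all? (λ q → length p ≤? length q) (paths K s t)

  -- The distance is attained: a minimal member of `paths` is compared with the list obtained from
  -- `st` and so has length at most that of a walk of `δ` steps. Conversely a walk of `δ` steps is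
  -- in `paths` because `shortest!` makes its vertices distinct.
  shortestPaths-↭ : ∀ {s t δ} → Dist t δ s → shortestPaths K s t ↭ walks δ s t
  shortestPaths-↭ {s} {t} {δ} (st , min) =
    unique-⇔⇒↭ (Uniqueₚ.filter⁺ (shortest? s t) (paths! s t)) (walks! δ s t) to from
    where
    path : ∀ {p} → WalkList t δ s p → p ∈ paths K s t
    path w = ∈-paths⁺ (wl-head w , wl-last w , wl-linked w , shortest! w min)
    to : ∀ {p} → p ∈ shortestPaths K s t → p ∈ walks δ s t
    to p∈ with p∈paths , p≤ ← ∈-filter⁻ (shortest? s t) {xs = paths K s t} p∈
          with h , l , lnk , _ ← ∈-paths⁻ p∈paths
          with k , w ← wl-intro h l lnk
          with q , wq ← walk⇒wl st
          with refl ← ≤-antisym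
                 (ℕₚ.≤-pred (subst₂ _≤_ (wl-length w) (wl-length wq) (All.lookup p≤ (path wq))))
                 (min (wl⇒walk w))
      = ∈-walks⁺ w
    from : ∀ {p} → p ∈ walks δ s t → p ∈ shortestPaths K s t
    from p∈ = ∈-filter⁺ (shortest? s t) (path w) (All.tabulate λ q∈ →
        let h , l , lnk , _ = ∈-paths⁻ q∈
            _ , wq = wl-intro h l lnk
        in subst₂ _≤_ (sym (wl-length w)) (sym (wl-length wq)) (s≤s (min (wl⇒walk wq))))
      where w = ∈-walks⁻ δ p∈

  σ-N : ∀ {s t δ} → Dist t δ s → σ K s t ≡ N δ s t
  σ-N {s} {t} {δ} d = trans (↭ₚ.↭-length (shortestPaths-↭ d)) (length-walks δ s t)

  shortestPaths-none : ∀ {s t} → (∀ j → ¬ Walk (Adj K) t j s) → shortestPaths K s t ≡ []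
  shortestPaths-none {s} {t} none with shortestPaths K s t in eq
  ... | []    = refl
  ... | p ∷ _
    with p∈paths , _ ← ∈-filter⁻ (shortest? s t) {xs = paths K s t} (subst (p ∈_) (sym eq) (here refl))
    with h , l , lnk , _ ← ∈-paths⁻ p∈paths
    with k , w ← wl-intro h l lnk
    = contradiction (wl⇒walk w) (none k)

  -- Shortest walks through a given vertex.

  module Through (w : Fin n) where

    through : ℕ → Fin n → Fin n → ℕ
    through k x t = length (filter (w ∈?_) (walks k x t))

    through-here : ∀ k t → through k w t ≡ N k w t
    through-here k t = trans
      (cong length (filter-all (w ∈?_) (All.tabulate λ p∈ → starts (∈-walks⁻ k p∈))))
      (length-walks k w t)
      where
      starts : ∀ {p} → WalkList t k w p → w ∈ p
      starts (end _)   = here refl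
      starts (_ ∷ _) = here refl

    through-zero : ∀ {x} t → w ≢ x → through 0 x t ≡ 0
    through-zero {x} t w≢x =
      cong length (filter-none (w ∈?_) (All.tabulate λ p∈ → misses (∈-walks⁻ 0 p∈)))
      where
      misses : ∀ {p} → WalkList t 0 x p → w ∉ p
      misses (end _) (here w≡x) = w≢x w≡x

    through-suc : ∀ {k x} t → w ≢ x → through (suc k) x t ≡ ∑[ y < n ] (ind (adj? K x y) * through k y t)
    through-suc {k} {x} t w≢x = begin
      length (filter (w ∈?_) (concat (tabulate (block x L))))
        ≡⟨ cong length (filter-concat-tabulate (w ∈?_) (block x L)) ⟩
      length (concat (tabulate (filter (w ∈?_) ∘ block x L)))
        ≡⟨ length-concat-tabulate (filter (w ∈?_) ∘ block x L) ⟩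
      ∑[ y < n ] length (filter (w ∈?_) (block x L y))        ≡⟨ sum-cong-≗ each ⟩
      ∑[ y < n ] (ind (adj? K x y) * through k y t)       ∎
      where
      open ≡-Reasoning
      L : Fin n → List (List (Fin n))
      L y = walks k y t
      tail∈ : ∀ {p} → w ∈ x ∷ p → w ∈ p
      tail∈ (here w≡x)  = contradiction w≡x w≢x
      tail∈ (there w∈p) = w∈p
      each : ∀ y → length (filter (w ∈?_) (block x L y)) ≡ ind (adj? K x y) * through k y t
      each y with adj? K x y
      ... | no _  = refl
      ... | yes _ = trans (length-filter-map (w ∈?_) (x ∷_) (walks k y t))
        (trans (cong length (filter-≐ (λ p → w ∈? (x ∷ p)) (w ∈?_) (tail∈ , there) (walks k y t)))
               (sym (+-identityʳ _)))

    through-none : ∀ {k x t} → ¬ Walk (Adj K) t k x → through k x t ≡ 0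
    through-none {k} {x} {t} none = ℕₚ.n≤0⇒n≡0 (≤-trans (length-filter (w ∈?_) (walks k x t))
      (≤-reflexive (trans (length-walks k x t) (N-null none))))

    -- The walk would give `g y ≤ k` and the edge from level `suc k` gives `k ≤ g y`. So in the
    -- recursion on the length only the neighbours on level `k` matter.
    far-from-end : ∀ {g t k x y} → Lipschitz g → g t ≡ 0 → g x ≡ suc k → Adj K x y → g y ≢ k →
                   ¬ Walk (Adj K) t k y
    far-from-end {g} {t} {k} lip gt≡0 gx≡ xy y≢k p = y≢k (≤-antisym
      (≤-trans (Climb.rise≤length g lip t p) (≤-reflexive (trans (cong (k +_) gt≡0) (+-identityʳ k))))
      (ℕₚ.≤-pred (≤-trans (≤-reflexive (sym gx≡)) (lip xy))))

    -- g plays the distance to t, for which the walks counted are shortest.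
    through-product : ∀ {g t} → Lipschitz g → g t ≡ 0 → ∀ k {x} → g x ≡ k →
                      through k x t ≡ N (k ∸ g w) x w * N (g w) w t
    through-product {g} {t} lip gt≡0 k {x} gx≡k with w ≟ x
    ... | yes refl rewrite sym gx≡k | ℕₚ.n∸n≡0 (g w) | ind-true (w ≟ w) refl =
      trans (through-here (g w) t) (sym (+-identityʳ _))
    through-product {g} {t} lip gt≡0 zero {x} gx≡k | no w≢x
      rewrite ℕₚ.0∸n≡0 (g w) | ind-false (x ≟ w) (w≢x ∘ sym) = through-zero t w≢x
    through-product {g} {t} lip gt≡0 (suc k) {x} gx≡k | no w≢x with g w ≤? k
    -- Here `w` is no nearer to `t` than `x`: the truncated length is 0 and the first factor
    -- vanishes because `x` is not `w`. The same happens at each neighbour on level `k`.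
    ... | no w≰k rewrite m≤n⇒m∸n≡0 (≰⇒> w≰k) | ind-false (x ≟ w) (w≢x ∘ sym) =
      trans (through-suc {k} t w≢x) (∑-zero λ y → ind-*-null (adj? K x y) (each y))
      where
      each : ∀ y → Adj K x y → through k y t ≡ 0
      each y xy with g y ℕₚ.≟ k
      ... | no y≢k = through-none (far-from-end lip gt≡0 gx≡k xy y≢k)
      ... | yes y≡k = trans (through-product lip gt≡0 k y≡k) (cong (_* N (g w) w t)
        (trans (cong (λ j → N j y w) (m≤n⇒m∸n≡0 (<⇒≤ (≰⇒> w≰k))))
               (ind-false (y ≟ w) λ { refl → w≰k (≤-reflexive y≡k) })))
    ... | yes w≤k rewrite +-∸-assoc 1 w≤k = trans (through-suc {k} t w≢x) (begin
        ∑[ y < n ] (ind (adj? K x y) * through k y t)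
          ≡⟨ sum-cong-≗ (λ y → ind-*-cong (adj? K x y) (each y)) ⟩
        ∑[ y < n ] (ind (adj? K x y) * (N (k ∸ g w) y w * N (g w) w t))
          ≡⟨ sum-cong-≗ (λ y → *-assoc (ind (adj? K x y)) (N (k ∸ g w) y w) (N (g w) w t)) ⟨
        ∑[ y < n ] (ind (adj? K x y) * N (k ∸ g w) y w * N (g w) w t)
          ≡⟨ *-distribʳ-sum (N (g w) w t) (λ y → ind (adj? K x y) * N (k ∸ g w) y w) ⟨
        ∑[ y < n ] (ind (adj? K x y) * N (k ∸ g w) y w) * N (g w) w t ∎)
      where
      open ≡-Reasoning
      each : ∀ y → Adj K x y → through k y t ≡ N (k ∸ g w) y w * N (g w) w t
      each y xy with g y ℕₚ.≟ k
      ... | yes y≡k = through-product lip gt≡0 k y≡k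
      ... | no y≢k = trans (through-none (far-from-end lip gt≡0 gx≡k xy y≢k))
        (sym (cong (_* N (g w) w t) (N-null λ p → y≢k (≤-antisym
          (≤-trans (Climb.rise≤length g lip w p) (≤-reflexive (m∸n+n≡m w≤k)))
          (ℕₚ.≤-pred (≤-trans (≤-reflexive (sym gx≡k)) (lip xy)))))))

-- Breadth-first search of a relation.

∈-∷ʳ⁻ : ∀ {x w : A} D → x ∈ D ∷ʳ w → x ∈ D ⊎ x ≡ w
∈-∷ʳ⁻ D x∈ with ∈-++⁻ D x∈
... | inj₁ x∈D        = inj₁ x∈D
... | inj₂ (here x≡w) = inj₂ x≡w

∷ʳ! : ∀ {x : A} {V} → Unique V → x ∉ V → Unique (V ∷ʳ x)
∷ʳ! V! x∉V = Uniqueₚ.++⁺ V! ([] ∷ []) λ { (v∈ , here refl) → x∉V v∈ }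

unique-++⇒∉ : ∀ (D : List A) {w q} → Unique (D ++ w ∷ q) → w ∉ D
unique-++⇒∉ (x ∷ D) (x≢ ∷ _)  (here refl) = All.lookup x≢ (∈-insert D) refl
unique-++⇒∉ (x ∷ D) (_ ∷ D!) (there w∈)  = unique-++⇒∉ D D! w∈

unique-++ˡ : ∀ (D : List A) {q} → Unique (D ++ q) → Unique D
unique-++ˡ []      _         = []
unique-++ˡ (x ∷ D) (x≢ ∷ D!) = Allₚ.++⁻ˡ D x≢ ∷ unique-++ˡ D D!

foldl-fusion : ∀ {U : Set} (h : A → B) {f : A → U → A} {g : B → U → B} →
               (∀ a u → h (f a u) ≡ g (h a) u) → ∀ us a → h (foldl f a us) ≡ foldl g (h a) us
foldl-fusion h {g = g} eq []       a = refl
foldl-fusion h {g = g} eq (u ∷ us) a =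
  trans (foldl-fusion h eq us _) (cong (λ b → foldl g b us) (eq a u))

foldl-frame : ∀ {U : Set} (h : A → B) {f : A → U → A} → (∀ a u → h (f a u) ≡ h a) →
              ∀ us a → h (foldl f a us) ≡ h a
foldl-frame h eq []       a = refl
foldl-frame h eq (u ∷ us) a = trans (foldl-frame h eq us _) (eq a u)

module Layers {n} (R : Rel (Fin n) 0ℓ) (r : Fin n) where

  -- D lists the dequeued vertices in order, and the queue is Q₁ ++ Q₂, with Q₁
  -- at depth k and Q₂ at depth k + 1.
  record Layered (k : ℕ) (D Q₁ Q₂ : List (Fin n)) : Set where
    field
      unique : Unique (D ++ Q₁ ++ Q₂)
      past   : ∀ {u} → u ∈ D → ∃[ j ] j ≤ k × Walk R r j u
      now    : ∀ {u} → u ∈ Q₁ → Walk R r k u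
      next   : ∀ {u} → u ∈ Q₂ → Walk R r (suc k) u
      below  : ∀ {j u} → j < k → Walk R r j u → u ∈ D
      level  : ∀ {u} → Walk R r k u → u ∈ D ⊎ u ∈ Q₁
      closed : ∀ {w u} → w ∈ D → R w u → u ∈ D ++ Q₁ ++ Q₂

  open Layered public

  start : Layered 0 [] (r ∷ []) []
  unique start       = [] ∷ []
  past   start ()
  now    start (here refl) = here
  next   start ()
  below  start ()
  level  start here  = inj₂ (here refl)
  closed start ()

  -- With depth `k` used up, the last but one vertex of a walk of length `suc k` is in `D` by
  -- `level`, so `closed` puts its end in `D` or in `Q₂`.
  descend : ∀ {k D Q₂} → Layered k D [] Q₂ → Layered (suc k) D Q₂ []
  unique (descend {D = D} {Q₂} L) = subst (λ q → Unique (D ++ q)) (sym (++-identityʳ Q₂)) (unique L)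
  past   (descend L) u∈D with j , j≤k , p ← past L u∈D = j , m≤n⇒m≤1+n j≤k , p
  now    (descend L)     = next L
  next   (descend L) ()
  below  (descend {k} L) {j} j<1+k p with ℕₚ.m≤n⇒m<n∨m≡n (ℕₚ.≤-pred j<1+k)
  ... | inj₁ j<k  = below L j<k p
  ... | inj₂ refl with inj₁ u∈D ← level L p = u∈D
  level  (descend {D = D} L) (step wu p) with inj₁ w∈D ← level L p = ∈-++⁻ D (closed L w∈D wu)
  closed (descend {D = D} {Q₂} L) {u = u} w∈D wu =
    subst (λ q → u ∈ D ++ q) (sym (++-identityʳ Q₂)) (closed L w∈D wu)

  -- The depth increases lazily, when the first vertex of the next layer is dequeued.
  dequeue-split : ∀ {k D} Q₁ {Q₂ w q} → Layered k D Q₁ Q₂ → Q₁ ++ Q₂ ≡ w ∷ q →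
                  ∃[ k′ ] ∃[ Q₁′ ] ∃[ Q₂′ ] q ≡ Q₁′ ++ Q₂′ × Layered k′ D (w ∷ Q₁′) Q₂′
  dequeue-split []       {q = q} L refl = _ , q , [] , sym (++-identityʳ q) , descend L
  dequeue-split (_ ∷ Q₁)         L refl = _ , Q₁ , _ , refl , L

  -- A trace of the inner loop that forgets how the algorithm decides. The premise of `skip` covers
  -- a vertex already known as well as one that is no successor of `w`.
  data Grow (D : List (Fin n)) (w : Fin n) : (us q q′ : List (Fin n)) → Set where
    done : ∀ {q} → Grow D w [] q q
    skip : ∀ {u us q q′} → (R w u → u ∈ D ++ q) → Grow D w us q q′ → Grow D w (u ∷ us) q q′
    push : ∀ {u us q q′} → R w u → u ∉ D ++ q → Grow D w us (q ∷ʳ u) q′ → Grow D w (u ∷ us) q q′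

  record Grown (D : List (Fin n)) (w : Fin n) (us q q′ : List (Fin n)) : Set where
    field
      new      : List (Fin n)
      appended : q′ ≡ q ++ new
      fresh    : Unique (D ++ q′)
      sound    : ∀ {u} → u ∈ new → R w u
      complete : ∀ {u} → u ∈ us → R w u → u ∈ D ++ q′

  open Grown

  grown : ∀ {D w us q q′} → Unique (D ++ q) → Grow D w us q q′ → Grown D w us q q′
  grown {q = q} V! done = record
    { new = [] ; appended = sym (++-identityʳ q) ; fresh = V! ; sound = λ () ; complete = λ () }
  grown {D} {w} {q = q} {q′} V! (skip {u} {us} seen g) = record
    { G ; complete = λ { (here refl) wu → u∈ (seen wu) ; (there v∈) → complete G v∈ } }
    where
    module G = Grown (grown V! g)
    G = grown V! g
    u∈ : u ∈ D ++ q → u ∈ D ++ q′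
    u∈ p rewrite appended G = subst (u ∈_) (++-assoc D q (new G)) (∈-++⁺ˡ p)
  grown {D} {w} {q = q} {q′} V! (push {u} wu u∉ g) = record
    { new      = u ∷ new G
    ; appended = trans (appended G) (∷ʳ-++ q u (new G))
    ; fresh    = fresh G
    ; sound    = λ { (here refl) → wu ; (there v∈) → sound G v∈ }
    ; complete = λ { (here refl) _ → u∈ ; (there v∈) → complete G v∈ }
    }
    where
    G = grown (subst Unique (++-assoc D q (u ∷ [])) (∷ʳ! V! u∉)) g
    u∈ : u ∈ D ++ q′
    u∈ rewrite appended G | ∷ʳ-++ q u (new G) = ∈-++⁺ʳ D (∈-insert q)

  advance : ∀ {k D w us Q₁ Q₂ q′} → Layered k D (w ∷ Q₁) Q₂ → (∀ {u} → R w u → u ∈ us) →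
            Grow (D ∷ʳ w) w us (Q₁ ++ Q₂) q′ →
            ∃[ Q₂′ ] q′ ≡ Q₁ ++ Q₂′ × Layered k (D ∷ʳ w) Q₁ Q₂′
  advance {k} {D} {w} {us} {Q₁} {Q₂} {q′} L succ g = Q₂ ++ new G , eq , record
    { unique = subst (λ q → Unique ((D ∷ʳ w) ++ q)) eq (fresh G)
    ; past   = λ u∈ → past′ (∈-∷ʳ⁻ D u∈)
    ; now    = λ u∈ → now L (there u∈)
    ; next   = λ u∈ → next′ (∈-++⁻ Q₂ u∈)
    ; below  = λ j<k p → ∈-++⁺ˡ (below L j<k p)
    ; level  = λ p → level′ (level L p)
    ; closed = λ x∈ xu → closed′ (∈-∷ʳ⁻ D x∈) xu
    }
    where
    G : Grown (D ∷ʳ w) w us (Q₁ ++ Q₂) q′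
    G = grown (subst Unique (sym (∷ʳ-++ D w (Q₁ ++ Q₂))) (unique L)) g
    eq : q′ ≡ Q₁ ++ (Q₂ ++ new G)
    eq = trans (appended G) (++-assoc Q₁ Q₂ (new G))
    past′ : ∀ {u} → u ∈ D ⊎ u ≡ w → ∃[ j ] j ≤ k × Walk R r j u
    past′ (inj₁ u∈D)  = past L u∈D
    past′ (inj₂ refl) = k , ≤-refl , now L (here refl)
    next′ : ∀ {u} → u ∈ Q₂ ⊎ u ∈ new G → Walk R r (suc k) u
    next′ (inj₁ u∈)  = next L u∈
    next′ (inj₂ u∈)  = step (sound G u∈) (now L (here refl))
    level′ : ∀ {u} → u ∈ D ⊎ u ∈ w ∷ Q₁ → u ∈ D ∷ʳ w ⊎ u ∈ Q₁
    level′ (inj₁ u∈D)         = inj₁ (∈-++⁺ˡ u∈D)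
    level′ (inj₂ (here refl)) = inj₁ (∈-++⁺ʳ D (here refl))
    level′ (inj₂ (there u∈))  = inj₂ u∈
    closed′ : ∀ {x u} → x ∈ D ⊎ x ≡ w → R x u → u ∈ (D ∷ʳ w) ++ Q₁ ++ (Q₂ ++ new G)
    closed′ {u = u} (inj₁ x∈D) xu = subst (u ∈_)
      (trans (++-assoc (D ∷ʳ w) (Q₁ ++ Q₂) (new G)) (cong ((D ∷ʳ w) ++_) (++-assoc Q₁ Q₂ (new G))))
      (∈-++⁺ˡ (subst (u ∈_) (sym (∷ʳ-++ D w (Q₁ ++ Q₂))) (closed L x∈D xu)))
    closed′ {u = u} (inj₂ refl) wu = subst (λ q → u ∈ (D ∷ʳ w) ++ q) eq (complete G (succ wu) wu)

  exhausted : ∀ {k D} → Layered k D [] [] → ∀ {j u} → Walk R r j u → u ∈ D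
  exhausted {zero} L here with inj₁ r∈ ← level L here = r∈
  exhausted {suc k} L here = below L (s≤s z≤n) here
  exhausted {D = D} L {u = u} (step wu p) = subst (u ∈_) (++-identityʳ D) (closed L (exhausted L p) wu)

  -- A shorter walk would put `w` in `D` by `below`, but it is still in the queue.
  minimal : ∀ {k D w Q₁ Q₂ j} → Layered k D (w ∷ Q₁) Q₂ → Walk R r j w → k ≤ j
  minimal {D = D} L p = ≮⇒≥ λ j<k → unique-++⇒∉ D (unique L) (below L j<k p)

  Preserves : (Fin n → List (Fin n)) → (Fin n → State n → Fin n → State n) →
              (List (Fin n) → State n → Set) → Set
  Preserves Γ visit P = ∀ {k D w Q₁ Q₂ S} → Layered k D (w ∷ Q₁) Q₂ → Q S ≡ w ∷ Q₁ ++ Q₂ → P D S →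
    let S′ = foldl (visit w) (record S { Q = Q₁ ++ Q₂ }) (Γ w) in
    Grow (D ∷ʳ w) w (Γ w) (Q₁ ++ Q₂) (Q S′) × P (D ∷ʳ w) S′

  -- `succ` asks only that `Γ` contain the successors. In the third search it lists all neighbours,
  -- and the body must skip those that do not descend.
  module Search (Γ : Fin n → List (Fin n)) (visit : Fin n → State n → Fin n → State n)
                (succ : ∀ {w u} → R w u → u ∈ Γ w)
                (P : List (Fin n) → State n → Set) (body : Preserves Γ visit P) where

    Inv : List (Fin n) → State n → Set
    Inv D S = ∃[ k ] ∃[ Q₁ ] ∃[ Q₂ ] Q S ≡ Q₁ ++ Q₂ × Layered k D Q₁ Q₂ × P D S

    inv-step : ∀ {D S w q} → Inv D S → Q S ≡ w ∷ q →
               Inv (D ∷ʳ w) (foldl (visit w) (record S { Q = q }) (Γ w))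
    inv-step (_ , Q₁ , _ , QS≡ , L , p) QS≡w∷q
      with k , Q₁ , _ , refl , L ← dequeue-split Q₁ L (trans (sym QS≡) QS≡w∷q)
      with g , p ← body L QS≡w∷q p
      with Q₂ , eq , L ← advance L succ g
      = k , Q₁ , Q₂ , eq , L , p

    length-∷ʳ : ∀ D {w : Fin n} → length (D ∷ʳ w) ≡ suc (length D)
    length-∷ʳ D = trans (length-++ D) (ℕₚ.+-comm _ 1)

    -- The fuel `m` bounds the number of vertices still to be dequeued: `D` has no repetition, so it
    -- never exceeds `n` entries.
    terminates : ∀ m {D S} → Inv D S → n ≤ m + length D → ∃ (While Γ visit S)
    terminates-from : ∀ m {D S} → Inv D S → n ≤ m + length D → ∀ q → Q S ≡ q → ∃ (While Γ visit S)
    terminates m {S = S} inv n≤ = terminates-from m inv n≤ (Q S) refl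
    terminates-from m       {S = S} inv n≤ []      eq = S , stop eq
    terminates-from zero    {D}     inv n≤ (w ∷ q) eq with _ , _ , _ , _ , L , _ ← inv-step inv eq =
      contradiction (≤-trans (s≤s n≤) (≤-trans (≤-reflexive (sym (length-∷ʳ D)))
        (unique⇒length≤ (unique-++ˡ (D ∷ʳ w) (unique L))))) (<-irrefl refl)
    terminates-from (suc m) {D}     inv n≤ (w ∷ q) eq
      with S′ , run ← terminates m (inv-step inv eq) (≤-trans n≤ (≤-reflexive
                        (trans (sym (+-suc m _)) (cong (m +_) (sym (length-∷ʳ D))))))
      = S′ , loop eq run

    result : ∀ {D S S′} → Inv D S → While Γ visit S S′ →
             ∃[ D′ ] Q S′ ≡ [] × (∀ {j u} → Walk R r j u → u ∈ D′) × P D′ S′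
    result {D} (_ , [] , [] , _ , L , p) (stop eq)           = D , eq , exhausted L , p
    result (_ , [] , _ ∷ _ , QS≡ , _) (stop eq)              with () ← trans (sym QS≡) eq
    result (_ , _ ∷ _ , _ , QS≡ , _) (stop eq)               with () ← trans (sym QS≡) eq
    result inv (loop eq run)                                 = result (inv-step inv eq) run

    start-inv : ∀ {S} → Q S ≡ r ∷ [] → P [] S → Inv [] S
    start-inv eq p = 0 , r ∷ [] , [] , eq , start , p

    run-exists : ∀ {S} → Q S ≡ r ∷ [] → P [] S → ∃ (While Γ visit S)
    run-exists eq p = terminates n (start-inv eq p) (≤-reflexive (sym (+-identityʳ n)))

    run-result : ∀ {S S′} → Q S ≡ r ∷ [] → P [] S → While Γ visit S S′ →
                 ∃[ D ] Q S′ ≡ [] × (∀ {j u} → Walk R r j u → u ∈ D) × P D S′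
    run-result eq p = result (start-inv eq p)

-- The two loop bodies, discovery and counting.

enq : Fin n → List (Fin n) → List (Fin n)
enq u q = if ⌊ u ∈? q ⌋ then q else q ∷ʳ u

enq-∈ : ∀ {u : Fin n} {q} → u ∈ q → enq u q ≡ q
enq-∈ {u = u} {q} u∈ with u ∈? q
... | yes _ = refl
... | no u∉ = contradiction u∈ u∉

enq-∉ : ∀ {u : Fin n} {q} → u ∉ q → enq u q ≡ q ∷ʳ u
enq-∉ {u = u} {q} u∉ with u ∈? q
... | yes u∈ = contradiction u∈ u∉
... | no _   = refl

-- Acts on the queue and one array of labels only, so that the first two searches share its
-- analysis.
discover : Fin n → List (Fin n) × (Fin n → ℤ) → Fin n → List (Fin n) × (Fin n → ℤ)
discover w (q , d) u =
  if ⌊ d u ℤ.<? 0ℤ ⌋ then (enq u q , updateAt d u (const (d w ℤ.+ 1ℤ))) else (q , d)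

discover-yes : ∀ {w u : Fin n} {q d} → d u ℤ.< 0ℤ → u ∉ q →
               discover w (q , d) u ≡ (q ∷ʳ u , updateAt d u (const (d w ℤ.+ 1ℤ)))
discover-yes {u = u} {d = d} d<0 u∉ with d u ℤ.<? 0ℤ
... | yes _  = cong (_, _) (enq-∉ u∉)
... | no d≮0 = contradiction d<0 d≮0

discover-no : ∀ {w u : Fin n} {q d} → ¬ d u ℤ.< 0ℤ → discover w (q , d) u ≡ (q , d)
discover-no {u = u} {d = d} d≮0 with d u ℤ.<? 0ℤ
... | yes d<0 = contradiction d<0 d≮0
... | no _    = refl

tally : Fin n → (Fin n → ℤ) → (Fin n → ℕ) → Fin n → (Fin n → ℕ)
tally w d σ u = if ⌊ d u ℤ.<? d w ⌋ then updateAt σ u (_+ σ w) else σ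

tally-at : ∀ (w : Fin n) d σ u → tally w d σ u u ≡ σ u + ind (d u ℤ.<? d w) * σ w
tally-at w d σ u with d u ℤ.<? d w
... | yes _ = trans (updateAt-updates u σ) (cong (σ u +_) (sym (+-identityʳ (σ w))))
... | no _  = sym (+-identityʳ (σ u))

tally-other : ∀ (w : Fin n) d σ {u x} → x ≢ u → tally w d σ u x ≡ σ x
tally-other w d σ {u} {x} x≢u with d u ℤ.<? d w
... | yes _ = updateAt-minimal x u σ x≢u
... | no _  = refl

-- `w ∉ us` keeps `σ w` constant during the loop, and each counter is raised at most once as `us`
-- has no repetition; the order of the neighbours is thus immaterial.
tally-all : ∀ (w : Fin n) d us σ → Unique us → w ∉ us → ∀ u →
            foldl (tally w d) σ us u ≡ σ u + ind (u ∈? us) * (ind (d u ℤ.<? d w) * σ w)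
tally-all w d []       σ _          _  u = sym (+-identityʳ (σ u))
tally-all w d (v ∷ us) σ (v≢ ∷ us!) w∉ u with u ≟ v
... | yes refl = begin
    foldl (tally w d) σ′ us u        ≡⟨ tally-all w d us σ′ us! (w∉ ∘ there) u ⟩
    σ′ u + ind (u ∈? us) * c′
      ≡⟨ cong (λ i → σ′ u + i * c′) (ind-false (u ∈? us) λ u∈ → All.lookup v≢ u∈ refl) ⟩
    σ′ u + 0                         ≡⟨ +-identityʳ (σ′ u) ⟩
    σ′ u                             ≡⟨ tally-at w d σ u ⟩
    σ u + c                          ≡⟨ cong (σ u +_) (+-identityʳ c) ⟨
    σ u + 1 * c                      ∎
  where
  open ≡-Reasoning
  σ′ = tally w d σ v
  c  = ind (d u ℤ.<? d w) * σ w
  c′ = ind (d u ℤ.<? d w) * σ′ w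
... | no u≢v = trans (tally-all w d us (tally w d σ v) us! (w∉ ∘ there) u) (cong₂ _+_
  (tally-other w d σ u≢v)
  (cong (λ s → ind (u ∈? us) * (ind (d u ℤ.<? d w) * s)) (tally-other w d σ (λ w≡v → w∉ (here w≡v)))))

-- Distance labels, and counters as partial sums.

module _ (K : Graph n) where

  open Counts K

  module Labelling (r : Fin n) where

    open Layers (Adj K) r

    record Labels (V : List (Fin n)) (d : Fin n → ℤ) : Set where
      field
        seen   : ∀ {x} → x ∈ V → ∃[ k ] d x ≡ ℤ.+ k × Dist K r k x
        unseen : ∀ {x} → x ∉ V → d x ≡ -1ℤ

    open Labels

    seen≮0 : ∀ {V d x} → Labels V d → x ∈ V → ¬ d x ℤ.< 0ℤ
    seen≮0 L x∈ d<0 with k , eq , _ ← seen L x∈ rewrite eq with ℤ.+<+ () ← d<0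

    unseen<0 : ∀ {V d x} → Labels V d → x ∉ V → d x ℤ.< 0ℤ
    unseen<0 L x∉ rewrite unseen L x∉ = ℤ.-<+

    label : ∀ {V d x k} → Labels V d → x ∈ V → Dist K r k x → d x ≡ ℤ.+ k
    label L x∈ (p , min) with k′ , eq , p′ , min′ ← seen L x∈ =
      trans eq (cong ℤ.+_ (≤-antisym (min′ p) (min p′)))

    extend : ∀ {V d u k} → Labels V d → Dist K r k u → Labels (V ∷ʳ u) (updateAt d u (const (ℤ.+ k)))
    seen (extend {V} {d} {u} {k} L δ) {x} x∈ with x ≟ u | ∈-∷ʳ⁻ V x∈
    ... | yes refl | _        = k , updateAt-updates u d , δ
    ... | no x≢u   | inj₁ x∈V with m , eq , δ′ ← seen L x∈V =
      m , trans (updateAt-minimal x u d x≢u) eq , δ′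
    ... | no x≢u   | inj₂ x≡u = contradiction x≡u x≢u
    unseen (extend {V} {d} {u} L δ) {x} x∉ =
      trans (updateAt-minimal x u d λ { refl → x∉ (∈-++⁺ʳ V (here refl)) }) (unseen L (x∉ ∘ ∈-++⁺ˡ))

    -- The hypothesis on walks of length at most `k` supplies minimality: an unseen neighbour of `w`
    -- is out of reach in `k` steps, so its distance is `suc k`.
    discover-all : ∀ {D k w} us {q d} → w ∈ D → Dist K r k w → (∀ {u} → u ∈ us → Adj K w u) →
                   (∀ {j u} → j ≤ k → Walk (Adj K) r j u → u ∈ D ++ q) → Labels (D ++ q) d →
                   let q′ , d′ = foldl (discover w) (q , d) us in
                   Grow D w us q q′ × Labels (D ++ q′) d′
    discover-all [] _ _ _ _ L = done , L
    discover-all {D} {k} {w} (u ∷ us) {q} {d} w∈ δ adj near L with u ∈? (D ++ q)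
    ... | yes u∈ rewrite discover-no {w = w} {u = u} {q = q} {d = d} (seen≮0 L u∈)
          with g , L′ ← discover-all us w∈ δ (adj ∘ there) near L = skip (λ _ → u∈) g , L′
    ... | no u∉ rewrite discover-yes {w = w} {d = d} (unseen<0 L u∉) (λ u∈q → u∉ (∈-++⁺ʳ D u∈q))
                      | label L (∈-++⁺ˡ w∈) δ
                      | ℕₚ.+-comm k 1
          with g , L′ ← discover-all us w∈ δ (adj ∘ there)
                 (λ j≤k p → subst (_ ∈_) (++-assoc D q (u ∷ [])) (∈-++⁺ˡ (near j≤k p)))
                 (subst (λ V → Labels V _) (++-assoc D q (u ∷ []))
                   (extend L (step (adj (here refl)) (proj₁ δ) , λ p → ≰⇒> λ j≤k → u∉ (near j≤k p))))
          = push (adj (here refl)) u∉ g , L′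

    initial-labels : Labels (r ∷ []) (updateAt (const -1ℤ) r (const 0ℤ))
    seen   initial-labels (here refl) = 0 , updateAt-updates r (const -1ℤ) , here , λ _ → z≤n
    unseen initial-labels {x} x∉      = updateAt-minimal x r (const -1ℤ) λ x≡r → x∉ (here x≡r)

    discovery : ∀ {k D w Q₁ Q₂ us d} → Layered k D (w ∷ Q₁) Q₂ → (∀ {u} → u ∈ us → Adj K w u) →
                Labels (D ++ w ∷ Q₁ ++ Q₂) d →
                let q′ , d′ = foldl (discover w) (Q₁ ++ Q₂ , d) us in
                Grow (D ∷ʳ w) w us (Q₁ ++ Q₂) q′ × Labels ((D ∷ʳ w) ++ q′) d′
    discovery {k} {D} {w} {Q₁} {Q₂} {us} {d} L adj ℓ =
      discover-all us (∈-++⁺ʳ D (here refl)) (now L (here refl) , minimal L) adj near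
        (subst (λ V → Labels V d) (sym (∷ʳ-++ D w (Q₁ ++ Q₂))) ℓ)
      where
      known : ∀ {j u} → j ≤ k → Walk (Adj K) r j u → u ∈ D ++ w ∷ Q₁ ++ Q₂
      known j≤k p with ℕₚ.m≤n⇒m<n∨m≡n j≤k
      ... | inj₁ j<k  = ∈-++⁺ˡ (below L j<k p)
      ... | inj₂ refl with level L p
      ...   | inj₁ u∈D = ∈-++⁺ˡ u∈D
      ...   | inj₂ u∈Q = ∈-++⁺ʳ D (∈-++⁺ˡ u∈Q)
      near : ∀ {j u} → j ≤ k → Walk (Adj K) r j u → u ∈ (D ∷ʳ w) ++ Q₁ ++ Q₂
      near {u = u} j≤k p = subst (u ∈_) (sym (∷ʳ-++ D w (Q₁ ++ Q₂))) (known j≤k p)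

  data Label (r x : Fin n) : ℤ → Set where
    at          : ∀ {k} → Dist K r k x → Label r x (ℤ.+ k)
    unreachable : (∀ {j} → ¬ Walk (Adj K) r j x) → Label r x -1ℤ

  Distances : Fin n → (Fin n → ℤ) → Set
  Distances r d = ∀ x → Label r x (d x)

  labels⇒distances : ∀ {r D d} → (∀ {j u} → Walk (Adj K) r j u → u ∈ D) →
                     Labelling.Labels r D d → Distances r d
  labels⇒distances {D = D} all L x with x ∈? D
  ... | yes x∈ with k , eq , δ ← Labelling.Labels.seen L x∈ rewrite eq = at δ
  ... | no x∉ rewrite Labelling.Labels.unseen L x∉ = unreachable λ p → x∉ (all p)

  abs-lipschitz : ∀ {r d} → Distances r d → Lipschitz (∣_∣ ∘ d)
  abs-lipschitz {r} {d} dist {x} {u} xu with d x | dist x | d u | dist u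
  ... | _ | at (_ , min)     | _ | at (p , _)       = min (step (adj-sym K xu) p)
  ... | _ | at (p , _)       | _ | unreachable none = contradiction (step xu p) none
  ... | _ | unreachable _    | _ | at _             = s≤s z≤n
  ... | _ | unreachable _    | _ | unreachable _    = s≤s z≤n

  -- Restricted to edges, where both ends are reachable or neither is. Elsewhere it can fail: -1 is
  -- below 0, and its absolute value is not.
  abs-<-⇔ : ∀ {r d} → Distances r d → ∀ {x u} → Adj K x u → d u ℤ.< d x ⇔ ∣ d u ∣ < ∣ d x ∣
  abs-<-⇔ {r} {d} dist {x} {u} xu with d x | dist x | d u | dist u
  ... | _ | at _             | _ | at _             = mk⇔ ℤₚ.drop‿+<+ ℤ.+<+
  ... | _ | at (p , _)       | _ | unreachable none = contradiction (step xu p) none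
  ... | _ | unreachable none | _ | at (p , _)       = contradiction (step (adj-sym K xu) p) none
  ... | _ | unreachable _    | _ | unreachable _    =
    mk⇔ (λ lt → contradiction lt (ℤₚ.<-irrefl refl)) (λ lt → contradiction lt (<-irrefl refl))

  module Tallying (g : Fin n → ℕ) (lip : Lipschitz g) (r : Fin n) where

    open Climb g lip r

    climb-term : Fin n → Fin n → ℕ
    climb-term u x = ind (adj? K x u) * (ind (g u <? g x) * F x)

    -- A dequeued `x` is credited with its final value `F x`, rather than with the counter it had
    -- when dequeued; `tallied-now` shows that the two agree.
    Tallied : List (Fin n) → (Fin n → ℕ) → Set
    Tallied D σ = ∀ u → σ u ≡ ind (u ≟ r) + ∑[ x < n ] (ind (x ∈? D) * climb-term u x)

    initial-tallied : Tallied [] (updateAt (const 0) r (const 1))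
    initial-tallied u = sym (trans
      (cong (ind (u ≟ r) +_) (∑-zero {n} λ _ → refl)) (trans (+-identityʳ _) (value u)))
      where
      value : ∀ u → ind (u ≟ r) ≡ updateAt (const 0) r (const 1) u
      value u with u ≟ r
      ... | yes refl = sym (updateAt-updates r (const 0))
      ... | no u≢r   = sym (updateAt-minimal u r (const 0) u≢r)

    tallied-complete : ∀ {D σ u} → Tallied D σ →
                       (∀ {x} → Adj K x u → g u < g x → F x ≢ 0 → x ∈ D) → σ u ≡ F u
    tallied-complete {D} {σ} {u} T all =
      trans (T u) (trans (cong (ind (u ≟ r) +_) (sum-cong-≗ each)) (sym (F-rec u)))
      where
      each : ∀ x → ind (x ∈? D) * climb-term u x ≡ climb-term u x
      each x with x ∈? D
      ... | yes _ = +-identityʳ _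
      ... | no x∉ = sym (ind-*-null (adj? K x u) λ xu → ind-*-null (g u <? g x) λ u<x → null xu u<x)
        where
        null : Adj K x u → g u < g x → F x ≡ 0
        null xu u<x with F x ℕₚ.≟ 0
        ... | yes F≡0 = F≡0
        ... | no F≢0  = contradiction (all xu u<x F≢0) x∉

    tallied-step : ∀ {D w σ d us} → Tallied D σ → w ∉ D → σ w ≡ F w →
                   Unique us → (∀ u → u ∈ us ⇔ Adj K w u) →
                   (∀ {u} → Adj K w u → d u ℤ.< d w ⇔ g u < g w) →
                   Tallied (D ∷ʳ w) (foldl (tally w d) σ us)
    tallied-step {D} {w} {σ} {d} {us} T w∉D σ≡F us! us⇔ d⇔g u = begin
      foldl (tally w d) σ us u                                ≡⟨ tally-all w d us σ us! w∉us u ⟩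
      σ u + ind (u ∈? us) * (ind (d u ℤ.<? d w) * σ w)        ≡⟨ cong₂ _+_ (T u) term ⟩
      ind (u ≟ r) + old + climb-term u w                      ≡⟨ +-assoc (ind (u ≟ r)) old _ ⟩
      ind (u ≟ r) + (old + climb-term u w)
        ≡⟨ cong (λ t → ind (u ≟ r) + (old + t)) (∑-δ w (climb-term u)) ⟨
      ind (u ≟ r) + (old + ∑[ x < n ] (ind (x ≟ w) * climb-term u x))
        ≡⟨ cong (ind (u ≟ r) +_) (∑-distrib-+ (λ x → ind (x ∈? D) * climb-term u x)
                                              (λ x → ind (x ≟ w) * climb-term u x)) ⟨
      ind (u ≟ r) + ∑[ x < n ] (ind (x ∈? D) * climb-term u x + ind (x ≟ w) * climb-term u x)
        ≡⟨ cong (ind (u ≟ r) +_) (sum-cong-≗ split) ⟨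
      ind (u ≟ r) + ∑[ x < n ] (ind (x ∈? (D ∷ʳ w)) * climb-term u x) ∎
      where
      open ≡-Reasoning
      open Equivalence
      old : ℕ
      old = ∑[ x < n ] (ind (x ∈? D) * climb-term u x)
      w∉us : w ∉ us
      w∉us w∈ = adj-irrefl K refl (to (us⇔ w) w∈)
      term : ind (u ∈? us) * (ind (d u ℤ.<? d w) * σ w) ≡ climb-term u w
      term = trans (cong (_* (ind (d u ℤ.<? d w) * σ w)) (ind-⇔ (us⇔ u) (u ∈? us) (adj? K w u)))
        (ind-*-cong (adj? K w u) λ wu → cong₂ _*_ (ind-⇔ (d⇔g wu) (d u ℤ.<? d w) (g u <? g w)) σ≡F)
      split : ∀ x → ind (x ∈? (D ∷ʳ w)) * climb-term u x ≡
                    ind (x ∈? D) * climb-term u x + ind (x ≟ w) * climb-term u x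
      split x with x ≟ w
      ... | yes refl rewrite ind-false (x ∈? D) w∉D | ind-true (x ∈? (D ∷ʳ x)) (∈-++⁺ʳ D (here refl)) = refl
      ... | no x≢w = trans
        (cong (_* climb-term u x) (ind-⇔ (mk⇔ from∷ʳ ∈-++⁺ˡ) (x ∈? (D ∷ʳ w)) (x ∈? D)))
        (sym (+-identityʳ _))
        where
        from∷ʳ : x ∈ D ∷ʳ w → x ∈ D
        from∷ʳ x∈ with ∈-∷ʳ⁻ D x∈
        ... | inj₁ x∈D = x∈D
        ... | inj₂ x≡w = contradiction x≡w x≢w

    -- `lift` ties the counts to the relation searched: a vertex with nonzero count is reached at
    -- depth at most its climb.
    module Along (R : Rel (Fin n) 0ℓ) (R⇒Adj : ∀ {w u} → R w u → Adj K w u)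
                 (lift : ∀ {x} → F x ≢ 0 → Walk R r (g r ∸ g x) x) where

      open Layers R r

      -- A contributor `x` has `g w < g x`, so its climb is less than that of `w`, which is at most
      -- the depth `k`. By `lift` it belongs to an earlier layer, hence to `D`.
      tallied-now : ∀ {k D w Q₁ Q₂ σ} → Layered k D (w ∷ Q₁) Q₂ → Tallied D σ → σ w ≡ F w
      tallied-now {k} {w = w} {σ = σ} L T = tallied-complete {σ = σ} T λ {x} _ w<x F≢0 →
        below L (ℕₚ.+-cancelʳ-< (g x) _ _ (begin-strict
          g r ∸ g x + g x ≡⟨ m∸n+n≡m (proj₁ (F-walk F≢0)) ⟩
          g r             ≤⟨ climb≤length (walk-map R⇒Adj (now L (here refl))) ⟩
          k + g w         <⟨ ℕₚ.+-monoʳ-< k w<x ⟩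
          k + g x         ∎)) (lift F≢0)
        where open ≤-Reasoning

      tallied-end : ∀ {D σ} → (∀ {j u} → Walk R r j u → u ∈ D) → Tallied D σ → ∀ u → σ u ≡ F u
      tallied-end {σ = σ} all T u = tallied-complete {σ = σ} T λ _ _ F≢0 → all (lift F≢0)

      tallied-advance : ∀ {k D w Q₁ Q₂ σ d us} → Layered k D (w ∷ Q₁) Q₂ → Tallied D σ →
                        Unique us → (∀ u → u ∈ us ⇔ Adj K w u) →
                        (∀ {u} → Adj K w u → d u ℤ.< d w ⇔ g u < g w) →
                        Tallied (D ∷ʳ w) (foldl (tally w d) σ us)
      tallied-advance {D = D} {σ = σ} L T us! us⇔ d⇔g =
        tallied-step {σ = σ} T (unique-++⇒∉ D (unique L)) (tallied-now {σ = σ} L T) us! us⇔ d⇔g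

-- What each visit changes and what it leaves alone.

enqueue-empty : ∀ (u : Fin n) S → Q S ≡ [] → enqueue u S ≡ record S { Q = u ∷ [] }
enqueue-empty u record { Q = [] } refl = refl

foldl-tally : ∀ {f : State n → Fin n → State n} {w}
              (d : State n → Fin n → ℤ) (σ : State n → Fin n → ℕ) →
              (∀ S u → d (f S u) ≡ d S) → (∀ S u → σ (f S u) ≡ tally w (d S) (σ S) u) →
              ∀ us S → σ (foldl f S us) ≡ foldl (tally w (d S)) (σ S) us
foldl-tally d σ fixed track []       S = refl
foldl-tally {f = f} {w} d σ fixed track (u ∷ us) S = trans (foldl-tally d σ fixed track us (f S u))
  (cong₂ (λ δ τ → foldl (tally w δ) τ us) (fixed S u) (track S u))

visit₁-discovers : ∀ w S (u : Fin n) →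
                   (Q (visit₁ w S u) , dₛ (visit₁ w S u)) ≡ discover w (Q S , dₛ S) u
visit₁-discovers w S u with dₛ S u ℤ.<? 0ℤ
... | no _ = refl
... | yes _ with u ∈? Q S
...   | yes _ = refl
...   | no _  = refl

visit₁-fixes : ∀ w S (u : Fin n) →
               (dₜ (visit₁ w S u) , σₛ (visit₁ w S u) , σₜ (visit₁ w S u)) ≡ (dₜ S , σₛ S , σₜ S)
visit₁-fixes w S u with dₛ S u ℤ.<? 0ℤ
... | no _ = refl
... | yes _ with u ∈? Q S
...   | yes _ = refl
...   | no _  = refl

discover-dₜ-discovers : ∀ w S (u : Fin n) →
                        (Q (discover-dₜ w S u) , dₜ (discover-dₜ w S u)) ≡ discover w (Q S , dₜ S) u
discover-dₜ-discovers w S u with dₜ S u ℤ.<? 0ℤ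
... | no _ = refl
... | yes _ with u ∈? Q S
...   | yes _ = refl
...   | no _  = refl

discover-dₜ-fixes : ∀ w S (u : Fin n) →
                    (dₛ (discover-dₜ w S u) , σₛ (discover-dₜ w S u) , σₜ (discover-dₜ w S u)) ≡
                    (dₛ S , σₛ S , σₜ S)
discover-dₜ-fixes w S u with dₜ S u ℤ.<? 0ℤ
... | no _ = refl
... | yes _ with u ∈? Q S
...   | yes _ = refl
...   | no _  = refl

count-σₜ-fixes : ∀ w S (u : Fin n) →
                 (Q (count-σₜ w S u) , dₛ (count-σₜ w S u) , dₜ (count-σₜ w S u) , σₛ (count-σₜ w S u)) ≡
                 (Q S , dₛ S , dₜ S , σₛ S)
count-σₜ-fixes w S u with dₛ S u ℤ.<? dₛ S w
... | no _  = refl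
... | yes _ = refl

count-σₜ-tallies : ∀ w S (u : Fin n) → σₜ (count-σₜ w S u) ≡ tally w (dₛ S) (σₜ S) u
count-σₜ-tallies w S u with dₛ S u ℤ.<? dₛ S w
... | no _  = refl
... | yes _ = refl

visit₂-discovers : ∀ w S (u : Fin n) →
                   (Q (visit₂ w S u) , dₜ (visit₂ w S u)) ≡ discover w (Q S , dₜ S) u
visit₂-discovers w S u = trans
  (cong (λ (q , _ , d , _) → q , d) (count-σₜ-fixes w (discover-dₜ w S u) u))
  (discover-dₜ-discovers w S u)

visit₂-fixes : ∀ w S (u : Fin n) → (dₛ (visit₂ w S u) , σₛ (visit₂ w S u)) ≡ (dₛ S , σₛ S)
visit₂-fixes w S u = trans
  (cong (λ (_ , d , _ , σ) → d , σ) (count-σₜ-fixes w (discover-dₜ w S u) u))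
  (cong (λ (d , σ , _) → d , σ) (discover-dₜ-fixes w S u))

-- Discovery precedes counting within one visit, but it touches neither of the arrays that counting
-- reads.
visit₂-tallies : ∀ w S (u : Fin n) → σₜ (visit₂ w S u) ≡ tally w (dₛ S) (σₜ S) u
visit₂-tallies w S u = trans (count-σₜ-tallies w (discover-dₜ w S u) u)
  (cong (λ (d , _ , σ) → tally w d σ u) (discover-dₜ-fixes w S u))

visit₃-fixes : ∀ w S (u : Fin n) → (dₜ (visit₃ w S u) , σₜ (visit₃ w S u)) ≡ (dₜ S , σₜ S)
visit₃-fixes w S u with dₜ S u ℤ.<? dₜ S w
... | no _ = refl
... | yes _ with u ∈? Q S
...   | yes _ = refl
...   | no _  = refl

visit₃-tallies : ∀ w S (u : Fin n) → σₛ (visit₃ w S u) ≡ tally w (dₜ S) (σₛ S) u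
visit₃-tallies w S u with dₜ S u ℤ.<? dₜ S w
... | no _ = refl
... | yes _ with u ∈? Q S
...   | yes _ = refl
...   | no _  = refl

visit₃-yes : ∀ w S (u : Fin n) → dₜ S u ℤ.< dₜ S w → Q (visit₃ w S u) ≡ enq u (Q S)
visit₃-yes w S u lt with dₜ S u ℤ.<? dₜ S w
... | no ≮ = contradiction lt ≮
... | yes _ with u ∈? Q S
...   | yes _ = refl
...   | no _  = refl

visit₃-no : ∀ w S (u : Fin n) → ¬ dₜ S u ℤ.< dₜ S w → Q (visit₃ w S u) ≡ Q S
visit₃-no w S u ≮ with dₜ S u ℤ.<? dₜ S w
... | no _   = refl
... | yes lt = contradiction lt ≮

-- The three searches for one edge.

module Edge (K : Graph n) (Γ : Fin n → List (Fin n)) (Γ! : ∀ w → Unique (Γ w))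
            (Γ⇔ : ∀ w u → u ∈ Γ w ⇔ Adj K w u) (s t : Fin n) where

  open Counts K
  open Equivalence

  e : Pair n
  e = s , t

  module First where

    open Layers (Adj K) s
    open Labelling K s

    P : List (Fin n) → State n → Set
    P D S = Labels (D ++ Q S) (dₛ S) ×
            (dₜ S , σₛ S , σₜ S) ≡ (dₜ (initial e) , σₛ (initial e) , σₜ (initial e))

    body : Preserves Γ visit₁ P
    body {D = D} {w} {Q₁} {Q₂} {S} L eq (ℓ , fixed)
      with g , ℓ′ ← subst (λ (q , d) → Grow (D ∷ʳ w) w (Γ w) (Q₁ ++ Q₂) q × Labels ((D ∷ʳ w) ++ q) d)
                      (sym (foldl-fusion (λ S → Q S , dₛ S) {g = discover w} (visit₁-discovers w)
                                         (Γ w) (record S { Q = Q₁ ++ Q₂ })))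
                      (discovery L (λ {u} → to (Γ⇔ w u)) (subst (λ q → Labels (D ++ q) (dₛ S)) eq ℓ))
      = g , ℓ′ , trans (foldl-frame (λ S → dₜ S , σₛ S , σₜ S) (visit₁-fixes w) (Γ w) _) fixed

    open Search Γ visit₁ (λ {w} {u} → from (Γ⇔ w u)) P body

    exists : ∃ (While Γ visit₁ (enqueue s (initial e)))
    exists = run-exists refl (initial-labels , refl)

    outcome : ∀ {S} → While Γ visit₁ (enqueue s (initial e)) S →
              Q S ≡ [] × Distances K s (dₛ S) ×
              (dₜ S , σₛ S , σₜ S) ≡ (dₜ (initial e) , σₛ (initial e) , σₜ (initial e))
    outcome {S} run with D , Q≡ , all , ℓ , fixed ← run-result refl (initial-labels , refl) run =
        Q≡
      , labels⇒distances K all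
          (subst (λ V → Labels V (dₛ S)) (trans (cong (D ++_) Q≡) (++-identityʳ D)) ℓ)
      , fixed

  module Second (d : Fin n → ℤ) (dist : Distances K s d) (τ : Fin n → ℕ) where

    g : Fin n → ℕ
    g x = ∣ d x ∣

    lip : Lipschitz g
    lip = abs-lipschitz K dist

    open Layers (Adj K) t
    open Labelling K t
    open Climb g lip t
    open Tallying K g lip t
    open Along (Adj K) (λ wu → wu) (proj₂ ∘ F-walk)

    P : List (Fin n) → State n → Set
    P D S = Labels (D ++ Q S) (dₜ S) × Tallied D (σₜ S) × (dₛ S , σₛ S) ≡ (d , τ)

    body : Preserves Γ visit₂ P
    body {D = D} {w} {Q₁} {Q₂} {S} L eq (ℓ , T , refl)
      with g , ℓ′ ← subst (λ (q , d) → Grow (D ∷ʳ w) w (Γ w) (Q₁ ++ Q₂) q × Labels ((D ∷ʳ w) ++ q) d)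
                      (sym (foldl-fusion (λ S → Q S , dₜ S) {g = discover w} (visit₂-discovers w)
                                         (Γ w) (record S { Q = Q₁ ++ Q₂ })))
                      (discovery L (λ {u} → to (Γ⇔ w u)) (subst (λ q → Labels (D ++ q) (dₜ S)) eq ℓ))
      = g , ℓ′
      , subst (Tallied (D ∷ʳ w))
          (sym (foldl-tally dₛ σₜ (λ S u → cong proj₁ (visit₂-fixes w S u)) (visit₂-tallies w)
                            (Γ w) (record S { Q = Q₁ ++ Q₂ })))
          (tallied-advance {σ = σₜ S} L T (Γ! w) (Γ⇔ w) (abs-<-⇔ K dist))
      , foldl-frame (λ S → dₛ S , σₛ S) (visit₂-fixes w) (Γ w) _

    open Search Γ visit₂ (λ {w} {u} → from (Γ⇔ w u)) P body

    Ready : State n → Set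
    Ready S = Q S ≡ [] × dₜ S ≡ dₜ (initial e) × σₜ S ≡ σₜ (initial e) × (dₛ S , σₛ S) ≡ (d , τ)

    ready : ∀ {S} → Ready S → Q (enqueue t S) ≡ t ∷ [] × P [] (enqueue t S)
    ready {S} (Q≡ , refl , refl , fixed) rewrite enqueue-empty t S Q≡ =
      refl , initial-labels , initial-tallied , fixed

    exists : ∀ {S} → Ready S → ∃ (While Γ visit₂ (enqueue t S))
    exists {S} rdy with Q≡ , p ← ready rdy = run-exists Q≡ p

    outcome : ∀ {S S′} → Ready S → While Γ visit₂ (enqueue t S) S′ →
              Q S′ ≡ [] × Distances K t (dₜ S′) ×
              (∀ u → σₜ S′ u ≡ climbing g t u) × (dₛ S′ , σₛ S′) ≡ (d , τ)
    outcome {S} {S′} rdy run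
      with Q≡ , p ← ready rdy
      with D , Q≡ , all , ℓ , T , fixed ← run-result Q≡ p run =
        Q≡
      , labels⇒distances K all
          (subst (λ V → Labels V (dₜ S′)) (trans (cong (D ++_) Q≡) (++-identityʳ D)) ℓ)
      , tallied-end {σ = σₜ S′} all T
      , fixed

  module Third (d : Fin n → ℤ) (dist : Distances K t d) (τ : Fin n → ℕ) where

    g : Fin n → ℕ
    g x = ∣ d x ∣

    lip : Lipschitz g
    lip = abs-lipschitz K dist

    open Climb g lip s
    open Layers Descends s
    open Tallying K g lip s
    open Along Descends proj₁ F-descent

    P : List (Fin n) → State n → Set
    P D S = Tallied D (σₛ S) × (dₜ S , σₜ S) ≡ (d , τ)

    -- Descents to a given vertex all have the same length, so the vertices
    -- below w are still undiscovered or in the queue when w is dequeued.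
    undequeued : ∀ {k D w Q₁ Q₂ u} → Layered k D (w ∷ Q₁) Q₂ → Descends w u → u ∉ D ∷ʳ w
    undequeued {k} {D} {u = u} L wu@(_ , u<w) u∈ with ∈-∷ʳ⁻ D u∈
    ... | inj₂ refl = <-irrefl refl u<w
    ... | inj₁ u∈D with j , j≤k , p ← past L u∈D =
      <⇒≱ (s≤s j≤k) (ℕₚ.+-cancelʳ-≤ (g u) _ _
        (≤-trans (descent-drop (step wu (now L (here refl)))) (climb≤length (walk-map proj₁ p))))

    -- This search marks no vertex as visited; only presence in the queue prevents a second
    -- enqueuing. The last hypothesis, provided by `undequeued`, excludes that a vertex comes back
    -- after it was dequeued.
    grow : ∀ D w us S → dₜ S ≡ d → (∀ {u} → u ∈ us → Adj K w u) → (∀ {u} → Descends w u → u ∉ D) →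
           Grow D w us (Q S) (Q (foldl (visit₃ w) S us))
    grow D w []       S eq adj new = done
    grow D w (u ∷ us) S refl adj new = extend (d u ℤ.<? d w) (u ∈? Q S)
      where
      q′ : List (Fin n)
      q′ = Q (foldl (visit₃ w) (visit₃ w S u) us)
      rest : Grow D w us (Q (visit₃ w S u)) q′
      rest = grow D w us (visit₃ w S u) (cong proj₁ (visit₃-fixes w S u)) (adj ∘ there) new
      wu : Adj K w u
      wu = adj (here refl)
      extend : Dec (d u ℤ.< d w) → Dec (u ∈ Q S) → Grow D w (u ∷ us) (Q S) q′
      extend (no d≮) _ = skip (λ (_ , u<w) → contradiction (from (abs-<-⇔ K dist wu) u<w) d≮)
        (subst (λ q → Grow D w us q q′) (visit₃-no w S u d≮) rest)
      extend (yes d<) (yes u∈) = skip (λ _ → ∈-++⁺ʳ D u∈)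
        (subst (λ q → Grow D w us q q′) (trans (visit₃-yes w S u d<) (enq-∈ u∈)) rest)
      extend (yes d<) (no u∉) = push u↓ ([ new u↓ , u∉ ]′ ∘ ∈-++⁻ D)
        (subst (λ q → Grow D w us q q′) (trans (visit₃-yes w S u d<) (enq-∉ u∉)) rest)
        where
        u↓ : Descends w u
        u↓ = wu , to (abs-<-⇔ K dist wu) d<

    body : Preserves Γ visit₃ P
    body {D = D} {w} {Q₁} {Q₂} {S} L eq (T , refl) =
        grow (D ∷ʳ w) w (Γ w) (record S { Q = Q₁ ++ Q₂ }) refl (λ {u} → to (Γ⇔ w u)) (undequeued L)
      , subst (Tallied (D ∷ʳ w))
          (sym (foldl-tally dₜ σₛ (λ S u → cong proj₁ (visit₃-fixes w S u)) (visit₃-tallies w)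
                            (Γ w) (record S { Q = Q₁ ++ Q₂ })))
          (tallied-advance {σ = σₛ S} L T (Γ! w) (Γ⇔ w) (abs-<-⇔ K dist))
      , foldl-frame (λ S → dₜ S , σₜ S) (visit₃-fixes w) (Γ w) _

    open Search Γ visit₃ (λ {w} {u} → from (Γ⇔ w u) ∘ proj₁) P body

    Ready : State n → Set
    Ready S = Q S ≡ [] × σₛ S ≡ σₛ (initial e) × (dₜ S , σₜ S) ≡ (d , τ)

    ready : ∀ {S} → Ready S → Q (enqueue s S) ≡ s ∷ [] × P [] (enqueue s S)
    ready {S} (Q≡ , refl , fixed) rewrite enqueue-empty s S Q≡ = refl , initial-tallied , fixed

    exists : ∀ {S} → Ready S → ∃ (While Γ visit₃ (enqueue s S))
    exists {S} rdy with Q≡ , p ← ready rdy = run-exists Q≡ p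

    outcome : ∀ {S S′} → Ready S → While Γ visit₃ (enqueue s S) S′ →
              (∀ u → σₛ S′ u ≡ climbing g s u) × σₜ S′ ≡ τ
    outcome {S} {S′} rdy run
      with Q≡ , p ← ready rdy
      with D , _ , all , T , fixed ← run-result Q≡ p run =
      tallied-end {σ = σₛ S′} all T , cong proj₂ fixed

  searches-exist : ∃ (Searches Γ e)
  searches-exist
    with S₁ , run₁ ← First.exists
    with Q₁ , dist₁ , fixed₁ ← First.outcome run₁
    with r₂ ← (Q₁ , cong proj₁ fixed₁ , cong (proj₂ ∘ proj₂) fixed₁ , refl)
    with S₂ , run₂ ← Second.exists (dₛ S₁) dist₁ (σₛ S₁) {S₁} r₂
    with Q₂ , dist₂ , _ , fixed₂ ← Second.outcome (dₛ S₁) dist₁ (σₛ S₁) {S₁} r₂ run₂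
    with S₃ , run₃ ← Third.exists (dₜ S₂) dist₂ (σₜ S₂) {S₂}
                       (Q₂ , trans (cong proj₂ fixed₂) (cong (proj₁ ∘ proj₂) fixed₁) , refl)
    = S₃ , S₁ , S₂ , run₁ , run₂ , run₃

  searches-outcome : ∀ {S} → Searches Γ e S →
                     ∃[ ds ] ∃[ dt ] Distances K s ds × Distances K t dt ×
                     (∀ u → σₛ S u ≡ climbing (∣_∣ ∘ dt) s u) ×
                     (∀ u → σₜ S u ≡ climbing (∣_∣ ∘ ds) t u)
  searches-outcome (S₁ , S₂ , run₁ , run₂ , run₃)
    with Q₁ , dist₁ , fixed₁ ← First.outcome run₁
    with Q₂ , dist₂ , σₜ≡ , fixed₂ ← Second.outcome (dₛ S₁) dist₁ (σₛ S₁) {S₁}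
                                       (Q₁ , cong proj₁ fixed₁ , cong (proj₂ ∘ proj₂) fixed₁ , refl) run₂
    with σₛ≡ , eq ← Third.outcome (dₜ S₂) dist₂ (σₜ S₂) {S₂}
                      (Q₂ , trans (cong proj₂ fixed₂) (cong (proj₁ ∘ proj₂) fixed₁) , refl) run₃
    = dₛ S₁ , dₜ S₂ , dist₁ , dist₂ , σₛ≡ , λ u → trans (cong (λ σ → σ u) eq) (σₜ≡ u)

-- The quotient contributed by one edge.

module _ (K : Graph n) where

  open Counts K

  walk-++ : ∀ {a b c j k} → Walk (Adj K) b j a → Walk (Adj K) c k b → Walk (Adj K) c (j + k) a
  walk-++ here       q = q
  walk-++ (step e p) q = step e (walk-++ p q)

  walk-reverse : ∀ {a b k} → Walk (Adj K) b k a → Walk (Adj K) a k b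
  walk-reverse here = here
  walk-reverse {a} {b} {suc k} (step e p) = subst (λ l → Walk (Adj K) a l b) (ℕₚ.+-comm k 1)
    (walk-++ (walk-reverse p) (step (adj-sym K e) here))

  distance-self : ∀ {r d} → Distances K r d → ∣ d r ∣ ≡ 0
  distance-self {r} {d} dist with d r | dist r
  ... | _ | at (_ , min)     = ℕₚ.n≤0⇒n≡0 (min here)
  ... | _ | unreachable none = contradiction here none

  distance-sym : ∀ {s t ds dt} → Distances K s ds → Distances K t dt → ∣ dt s ∣ ≡ ∣ ds t ∣
  distance-sym {s} {t} {ds} {dt} dist-s dist-t with dt s | dist-t s | ds t | dist-s t
  ... | _ | at (p , min)     | _ | at (p′ , min′)   = ≤-antisym (min (walk-reverse p′)) (min′ (walk-reverse p))
  ... | _ | at (p , _)       | _ | unreachable none = contradiction (walk-reverse p) none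
  ... | _ | unreachable none | _ | at (p , _)       = contradiction (walk-reverse p) none
  ... | _ | unreachable _    | _ | unreachable _    = refl

  -- A nonzero first factor puts w on a shortest path, so that its distance to
  -- t is what remains of the distance between s and t.
  climbing-product : ∀ {s t ds dt} → Distances K s ds → Distances K t dt → ∀ w →
    climbing (∣_∣ ∘ dt) s w * climbing (∣_∣ ∘ ds) t w ≡
    N (∣ dt s ∣ ∸ ∣ dt w ∣) s w * N ∣ dt w ∣ w t
  climbing-product {s} {t} {ds} {dt} dist-s dist-t w =
    trans (cong (_* climbing gs t w) (N-sym a w s)) (either (N-null⊎walk a s w))
    where
    gs gt : Fin n → ℕ
    gs = ∣_∣ ∘ ds
    gt = ∣_∣ ∘ dt
    a : ℕ
    a = gt s ∸ gt w
    either : N a s w ≡ 0 ⊎ Walk (Adj K) w a s →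
             N a s w * climbing gs t w ≡ N a s w * N (gt w) w t
    either (inj₁ null) = trans (cong (_* climbing gs t w) null) (sym (cong (_* N (gt w) w t) null))
    either (inj₂ p)    = cong (λ b → N a s w * N b w t) gap
      where
      gs≤a : gs w ≤ a
      gs≤a = ≤-trans (Climb.rise≤length gs (abs-lipschitz K dist-s) s (walk-reverse p))
                     (≤-reflexive (trans (cong (a +_) (distance-self dist-s)) (+-identityʳ a)))
      triangle : gt s ≤ gs w + gt w
      triangle with ds w | dist-s w
      ... | _ | at (q , _)       = Climb.climb≤length gt (abs-lipschitz K dist-t) s q
      ... | _ | unreachable none = contradiction (walk-reverse p) none
      a≤gs : a ≤ gs w
      a≤gs = ℕₚ.m≤n+o⇒m∸n≤o (gt s) (gt w) (≤-trans triangle (≤-reflexive (+-comm (gs w) (gt w))))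
      w≤s : gt w ≤ gt s
      w≤s with ℕₚ.≤-total (gt w) (gt s)
      ... | inj₁ w≤s = w≤s
      -- The truncated length `a` is 0 in this case, so `p` is trivial and `w` is `s`.
      ... | inj₂ s≤w with here ← subst (λ l → Walk (Adj K) w l s) (m≤n⇒m∸n≡0 s≤w) p = ≤-refl
      gap : gs t ∸ gs w ≡ gt w
      gap = begin
        gs t ∸ gs w          ≡⟨ cong (_∸ gs w) (distance-sym dist-s dist-t) ⟨
        gt s ∸ gs w          ≡⟨ cong (gt s ∸_) (≤-antisym gs≤a a≤gs) ⟩
        gt s ∸ (gt s ∸ gt w) ≡⟨ ℕₚ.m∸[m∸n]≡n w≤s ⟩
        gt w                 ∎
        where open ≡-Reasoning

  ratio : ∀ {s t ds dt} → Distances K s ds → Distances K t dt → ∀ w →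
          (climbing (∣_∣ ∘ dt) s w * climbing (∣_∣ ∘ ds) t w) ÷ climbing (∣_∣ ∘ dt) s t ≡
          σ-through K s t w ÷ σ K s t
  ratio {s} {t} {ds} {dt} dist-s dist-t w with dt s in eq | dist-t s
  -- Both denominators are 0, and `÷` then gives 0 for any numerators.
  ... | _ | unreachable none = trans
    (cong ((N (∣ -1ℤ ∣ ∸ ∣ dt w ∣) w s * climbing (∣_∣ ∘ ds) t w) ÷_)
          (N-null {∣ -1ℤ ∣ ∸ ∣ dt t ∣} λ p → none (walk-reverse p)))
    (sym (cong (λ l → σ-through K s t w ÷ length l) (shortestPaths-none K (λ _ → none))))
  ... | ℤ.+ δ | at dist = cong₂ _÷_
    (trans (subst (λ m → N (m ∸ ∣ dt w ∣) w s * climbing (∣_∣ ∘ ds) t w ≡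
                         N (m ∸ ∣ dt w ∣) s w * N ∣ dt w ∣ w t)
                  (cong ∣_∣ eq) (climbing-product dist-s dist-t w))
           (sym (trans (↭ₚ.↭-length (↭ₚ.filter-↭ (w ∈?_) (shortestPaths-↭ K dist)))
                       (through-product w (abs-lipschitz K dist-t) (distance-self dist-t) δ (cong ∣_∣ eq)))))
    (trans (cong (λ m → N (δ ∸ m) t s) (distance-self dist-t)) (trans (N-sym δ t s) (sym (σ-N K dist))))
    where open Through K

  -- For edges that a run takes from their larger end. Exchanging the ends swaps the factors and,
  -- distance and walk counts being symmetric, preserves the denominator.
  ratio-swap : ∀ {s t ds dt} → Distances K s ds → Distances K t dt → ∀ w →
               (climbing (∣_∣ ∘ dt) s w * climbing (∣_∣ ∘ ds) t w) ÷ climbing (∣_∣ ∘ dt) s t ≡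
               σ-through K t s w ÷ σ K t s
  ratio-swap {s} {t} {ds} {dt} dist-s dist-t w = trans
    (cong₂ _÷_ (*-comm (climbing (∣_∣ ∘ dt) s w) _)
               (trans (N-sym (∣ dt s ∣ ∸ ∣ dt t ∣) t s) (cong (λ l → N l s t)
                 (cong₂ _∸_ (distance-sym dist-s dist-t) (trans (distance-self dist-t) (sym (distance-self dist-s)))))))
    (ratio dist-t dist-s w)

module _ (K : Graph n) (Γ : Fin n → List (Fin n)) (Γ! : ∀ w → Unique (Γ w))
         (Γ⇔ : ∀ w u → u ∈ Γ w ⇔ Adj K w u) {s t : Fin n} where

  searches-ratio : ∀ {S} → Searches Γ (s , t) S → ∀ w →
                   (σₛ S w * σₜ S w) ÷ σₛ S t ≡ σ-through K s t w ÷ σ K s t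
  searches-ratio run w =
    let _ , _ , dist-s , dist-t , σₛ≡ , σₜ≡ = Edge.searches-outcome K Γ Γ! Γ⇔ s t run in
    trans (cong₂ _÷_ (cong₂ _*_ (σₛ≡ w) (σₜ≡ w)) (σₛ≡ t)) (ratio K dist-s dist-t w)

  searches-ratio-swap : ∀ {S} → Searches Γ (s , t) S → ∀ w →
                        (σₛ S w * σₜ S w) ÷ σₛ S t ≡ σ-through K t s w ÷ σ K t s
  searches-ratio-swap run w =
    let _ , _ , dist-s , dist-t , σₛ≡ , σₜ≡ = Edge.searches-outcome K Γ Γ! Γ⇔ s t run in
    trans (cong₂ _÷_ (cong₂ _*_ (σₛ≡ w) (σₜ≡ w)) (σₛ≡ t)) (ratio-swap K dist-s dist-t w)

-- Summation over the edges.

orient : Pair n → Pair n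
orient (s , t) with s Fin.<? t
... | yes _ = s , t
... | no _  = t , s

edge-score : Graph n → Fin n → Pair n → ℚ
edge-score G w (j , k) = σ-through (G ∖ (j , k)) j k w ÷ σ (G ∖ (j , k)) j k

avoids? : ∀ (w : Fin n) (e : Pair n) → Dec (¬ (w ≡ proj₁ e ⊎ w ≡ proj₂ e))
avoids? w (s , t) = ¬? (w ≟ s ⊎-dec w ≟ t)

sameEdge-sym : ∀ {e f : Pair n} → SameEdge e f → SameEdge f e
sameEdge-sym (inj₁ (refl , refl)) = inj₁ (refl , refl)
sameEdge-sym (inj₂ (refl , refl)) = inj₂ (refl , refl)

sameEdge-trans : ∀ {e f g : Pair n} → SameEdge e f → SameEdge f g → SameEdge e g
sameEdge-trans (inj₁ (refl , refl)) q                    = q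
sameEdge-trans (inj₂ (refl , refl)) (inj₁ (refl , refl)) = inj₂ (refl , refl)
sameEdge-trans (inj₂ (refl , refl)) (inj₂ (refl , refl)) = inj₁ (refl , refl)

orient-either : ∀ ((s , t) : Pair n) → orient (s , t) ≡ (s , t) ⊎ orient (s , t) ≡ (t , s)
orient-either (s , t) with s Fin.<? t
... | yes _ = inj₁ refl
... | no _  = inj₂ refl

orient-same : ∀ (e : Pair n) → SameEdge e (orient e)
orient-same (s , t) with s Fin.<? t
... | yes _ = inj₁ (refl , refl)
... | no _  = inj₂ (refl , refl)

orient-< : ∀ {s t : Fin n} → s ≢ t → proj₁ (orient (s , t)) Fin.< proj₂ (orient (s , t))
orient-< {s = s} {t} s≢t with s Fin.<? t
... | yes s<t = s<t
... | no s≮t with Finₚ.<-cmp s t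
...   | tri< s<t _ _ = contradiction s<t s≮t
...   | tri≈ _ s≡t _ = contradiction s≡t s≢t
...   | tri> _ _ t<s = t<s

sameEdge-<⇒≡ : ∀ {j k j′ k′ : Fin n} → SameEdge (j , k) (j′ , k′) →
               j Fin.< k → j′ Fin.< k′ → (j , k) ≡ (j′ , k′)
sameEdge-<⇒≡ (inj₁ (refl , refl)) _   _   = refl
sameEdge-<⇒≡ (inj₂ (refl , refl)) j<k k<j = contradiction j<k (Finₚ.<-asym k<j)

∈-removed : ∀ {x w : Fin n} → x ≢ w → x Subset.∈ ⊤ Subset.- w
∈-removed x≢w = x∈p∧x≢y⇒x∈p-y ∈⊤ x≢w

∉-removed : ∀ {x : Fin n} {p} → x Subset.∉ p Subset.- x
∉-removed {x = Fin.suc x} {_ ∷ p} (there x∈) = ∉-removed {p = p} x∈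

∑ℚ : List ℚ → ℚ
∑ℚ = foldr ℚ._+_ ℚ.0ℚ

-- The loop invariant: the value so far plus the sum over the pending edges stays the same. The ends
-- skipped by the algorithm match the edges dropped by the filter.
accumulate-sum : ∀ ((s , t) : Pair n) S C w es (f : Pair n → ℚ) →
                 (σₛ S w * σₜ S w) ÷ σₛ S t ≡ f (s , t) →
                 accumulate (s , t) S C w ℚ.+ ∑ℚ (map f (filter (avoids? w) es)) ≡
                 C w ℚ.+ ∑ℚ (map f (filter (avoids? w) ((s , t) ∷ es)))
accumulate-sum (s , t) S C w es f eq with w ≟ s ⊎-dec w ≟ t
... | yes w∈e = cong (λ l → C w ℚ.+ ∑ℚ (map f l)) (sym (filter-reject (avoids? w) (λ w∉e → w∉e w∈e)))
... | no w∉e  = trans (cong (λ q → C w ℚ.+ q ℚ.+ ∑ℚ (map f (filter (avoids? w) es))) eq)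
  (trans (ℚₚ.+-assoc (C w) (f (s , t)) _)
         (cong (λ l → C w ℚ.+ ∑ℚ (map f l)) (sym (filter-accept (avoids? w) w∉e))))

module Correct (G : Graph n) (o : LoopOrder G) where

  open LoopOrder o
  open Equivalence

  -- The graphs without `(s , t)` and without `(t , s)` differ as records but have the same adjacent
  -- pairs, so neighbour lists of one serve the other.
  Γ-nbrs-swap : ∀ s t w u → u ∈ Γ (s , t) w ⇔ Adj (G ∖ (t , s)) w u
  Γ-nbrs-swap s t w u = mk⇔
    (λ u∈ → let wu , ¬e = to (Γ-nbrs (s , t) w u) u∈ in wu , ¬e ∘ swap)
    (λ (wu , ¬e) → from (Γ-nbrs (s , t) w u) (wu , ¬e ∘ swap))

  run-score : ∀ s t {S} → Searches (Γ (s , t)) (s , t) S → ∀ w →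
              (σₛ S w * σₜ S w) ÷ σₛ S t ≡ edge-score G w (orient (s , t))
  run-score s t {S} run w with orient-either (s , t)
  ... | inj₁ eq = trans
    (searches-ratio (G ∖ (s , t)) (Γ (s , t)) (Γ-once (s , t)) (Γ-nbrs (s , t)) run w)
    (cong (edge-score G w) (sym eq))
  ... | inj₂ eq = trans
    (searches-ratio-swap (G ∖ (t , s)) (Γ (s , t)) (Γ-once (s , t)) (Γ-nbrs-swap s t) run w)
    (cong (edge-score G w) (sym eq))

  runs : ∀ s t → ∃ (Searches (Γ (s , t)) (s , t))
  runs s t = Edge.searches-exist (G ∖ (s , t)) (Γ (s , t)) (Γ-once (s , t)) (Γ-nbrs (s , t)) s t

  run-exists : ∀ es C → ∃ (ForEdges Γ es C)
  run-exists []       C = C , []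
  run-exists ((s , t) ∷ es) C =
    let S  , run  = runs s t
        C′ , rest = run-exists es (accumulate (s , t) S C)
    in C′ , run ∷ rest

  run-sum : ∀ {es C C′} → ForEdges Γ es C C′ → ∀ w →
            C′ w ≡ C w ℚ.+ ∑ℚ (map (edge-score G w ∘ orient) (filter (avoids? w) es))
  run-sum {C = C} [] w = sym (ℚₚ.+-identityʳ (C w))
  run-sum {(s , t) ∷ es} {C} (_∷_ {S = S} run rest) w = trans (run-sum rest w)
    (accumulate-sum (s , t) S C w es (edge-score G w ∘ orient) (run-score s t run w))

  -- Neither list has repetitions: two entries of `edges` with equal orientation would be the same
  -- edge. It remains to compare members, and a pair with the smaller end first is determined by its
  -- edge.
  oriented-↭ : ∀ w → map orient (filter (avoids? w) edges) ↭ E G (⊤ Subset.- w)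
  oriented-↭ w = unique-⇔⇒↭
    (AllPairsₚ.map⁺ (AllPairs.map distinct (AllPairsₚ.filter⁺ (avoids? w) edges-once)))
    (Uniqueₚ.filter⁺ inE? (Uniqueₚ.cartesianProduct⁺ (Uniqueₚ.allFin⁺ n) (Uniqueₚ.allFin⁺ n)))
    sound complete
    where
    inE? = λ ((j , k) : Pair n) → j Fin.<? k ×-dec adj? G j k ×-dec
                      j ∈ₛ? (⊤ Subset.- w) ×-dec k ∈ₛ? (⊤ Subset.- w)
    distinct : ∀ {e f} → ¬ SameEdge e f → orient e ≢ orient f
    distinct {e} {f} e≁f eq =
      e≁f (sameEdge-trans (subst (SameEdge e) eq (orient-same e)) (sameEdge-sym (orient-same f)))
    ∈E : ∀ {j k} → j Fin.< k → Adj G j k → j ≢ w → k ≢ w → (j , k) ∈ E G (⊤ Subset.- w)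
    ∈E {j} {k} j<k jk j≢w k≢w = ∈-filter⁺ inE? (∈-cartesianProduct⁺ (∈-allFin j) (∈-allFin k))
      (j<k , jk , ∈-removed j≢w , ∈-removed k≢w)
    sound : ∀ {e} → e ∈ map orient (filter (avoids? w) edges) → e ∈ E G (⊤ Subset.- w)
    sound e∈
      with (s , t) , e∈ , refl ← ∈-map⁻ orient e∈
      with e∈ , w∉e ← ∈-filter⁻ (avoids? w) {xs = edges} e∈
      with st ← All.lookup edges-sound e∈
      with orient (s , t) | orient-same (s , t) | orient-< {s = s} {t} (λ s≡t → adj-irrefl G s≡t st)
    ... | _ | inj₁ (refl , refl) | s<t = ∈E s<t st (w∉e ∘ inj₁ ∘ sym) (w∉e ∘ inj₂ ∘ sym)
    ... | _ | inj₂ (refl , refl) | t<s = ∈E t<s (adj-sym G st) (w∉e ∘ inj₂ ∘ sym) (w∉e ∘ inj₁ ∘ sym)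
    complete : ∀ {e} → e ∈ E G (⊤ Subset.- w) → e ∈ map orient (filter (avoids? w) edges)
    complete {j , k} e∈
      with _ , j<k , jk , j∈ , k∈ ← ∈-filter⁻ inE? {xs = cartesianProduct (allFin n) (allFin n)} e∈
      with (s , t) , f∈ , same ← find (edges-all j k jk)
      = subst (_∈ map orient (filter (avoids? w) edges))
          (sym (sameEdge-<⇒≡ (sameEdge-trans same (orient-same (s , t))) j<k
                 (orient-< λ s≡t → adj-irrefl G s≡t (All.lookup edges-sound f∈))))
          (∈-map⁺ orient (∈-filter⁺ (avoids? w) f∈ (missed same)))
      where
      missed : ∀ {s t} → SameEdge (j , k) (s , t) → ¬ (w ≡ s ⊎ w ≡ t)
      missed (inj₁ (refl , refl)) (inj₁ refl) = ∉-removed j∈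
      missed (inj₁ (refl , refl)) (inj₂ refl) = ∉-removed k∈
      missed (inj₂ (refl , refl)) (inj₁ refl) = ∉-removed k∈
      missed (inj₂ (refl , refl)) (inj₂ refl) = ∉-removed j∈

  sum≡score : ∀ w → ∑ℚ (map (edge-score G w ∘ orient) (filter (avoids? w) edges)) ≡ score G w
  sum≡score w = trans (cong ∑ℚ (map-∘ (filter (avoids? w) edges)))
    (↭ₛₚ.foldr-commMonoid (setoid ℚ) ℚₚ.+-0-isCommutativeMonoid
      (↭⇒↭ₛ (↭ₚ.map⁺ (edge-score G w) (oriented-↭ w))))

lemma1 : ∀ (n : ℕ) (G : Graph n) (o : LoopOrder G) →
    ∃ (PathCore G o) ×
    (∀ (Cₚ : Fin n → ℚ) → PathCore G o Cₚ → ∀ (w : Fin n) → Cₚ w ≡ score G w)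
lemma1 n G o = run-exists edges (const ℚ.0ℚ) , λ Cₚ run w →
    trans (run-sum run w) (trans (ℚₚ.+-identityˡ _) (sum≡score w))
  where
  open LoopOrder o
  open Correct G o
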